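{- Let $n$ and $k$ be integers with $3\le k< n/2$ and \[ n\ge\begin{cases} 8, & k=3,\\ 10, & k=4,\\ \frac{k(k+1)}{2}, & k \text{ odd and } k\ge 5,\\ \frac{k^2}{2}, & k \text{ even and } k\ge 6. \end{cases} \] Then the following hold (all $m,j$ below are integers with $m\ge 0$). \begin{enumerate} \item If $k\ge 3$, $k$ odd, $n$ even, and $\frac{n}{2}=mk+j$ with $\frac{k-1}{2}\le j<k$, then ${\rm diam}(GP(n,k))$ equals $m+2+j$ if $j=\frac{k-1}{2}$ or $j=\frac{k+1}{2}$; equals $m+3+k-j$ if $3\le 2j-k\le\frac{k+1}{2}$; equals $m+2+j-\frac{k-1}{2}$ if $2j-k>\frac{k+1}{2}$. \item If $k\ge 3$, $k$ odd, $n$ even, and $\frac{n}{2}=mk+j$ with $0\le j<\frac{k-1}{2}$, then ${\rm diam}(GP(n,k))$ equals $m+1+\frac{k+1}{2}$ if $j=0$ or $j=1$; equals $m+3+\frac{k-1}{2}-j$ if $4\le 2j\le\frac{k+1}{2}$; equals $m+2+j$ if $2j>\frac{k+1}{2}$. \item If $k\ge 3$, $k$ odd, $n$ odd, and $\frac{n-1}{2}=mk+j$ with $\frac{k-2}{2}\le j<k$, then ${\rm diam}(GP(n,k))$ equals $m+2+\frac{k-1}{2}$ if $j=\frac{k-1}{2}$; equals $m+2+k-j$ if $2\le 2j+1-k\le\frac{k+1}{2}$; equals $m+2+j-\frac{k-1}{2}$ if $2j+1-k>\frac{k+1}{2}$. \item If $k\ge 3$, $k$ odd, $n$ odd, and $\frac{n-1}{2}=mk+j$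 with $0\le j<\frac{k-2}{2}$, then ${\rm diam}(GP(n,k))$ equals $m+2+\frac{k-1}{2}-j$ if $1\le 2j+1\le\frac{k+1}{2}$; equals $m+2+j$ if $2j+1>\frac{k+1}{2}$. \item If $k\ge 4$, $k$ even, $n$ even, and $\frac{n}{2}=mk+j$ with $\frac{k-2}{2}\le j<k$, then ${\rm diam}(GP(n,k))$ equals $m+2+j$ if $j=\frac{k-2}{2}$ or $j=\frac{k}{2}$; equals $m+3+k-j$ if $2\le 2j-k\le\frac{k}{2}$; equals $m+2+j-\frac{k}{2}$ if $2j-k\ge\frac{k+2}{2}$. \item If $k\ge 4$, $k$ even, $n$ even, and $\frac{n}{2}=mk+j$ with $0\le j<\frac{k-2}{2}$, then ${\rm diam}(GP(n,k))$ equals $m+1+\frac{k}{2}$ if $j=0$; equals $m+2+\frac{k}{2}-j$ if $2\le 2j\le\frac{k}{2}$; equals $m+2+j$ if $2j\ge\frac{k+2}{2}$. \item If $k\ge 4$, $k$ even, $n$ odd, and $\frac{n-1}{2}=mk+j$ with $\frac{k-3}{2}\le j<k$, then ${\rm diam}(GP(n,k))$ equals $m+2+\frac{k-2}{2}$ if $j=\frac{k-2}{2}$; equals $m+2+k-j$ if $1\le 2j+1-k\le\frac{k}{2}$; equals $m+3+j-\frac{k}{2}$ if $2j+1-k\ge\frac{k+2}{2}$. \item If $k\ge 4$, $k$ even, $n$ odd, and $\frac{n-1}{2}=mk+j$ with $0\le j<\frac{k-3}{2}$, then ${\rm diam}(GP(n,k))$ equals $m+1+\frac{k}{2}$ if $j=0$;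 equals $m+2+\frac{k}{2}-j$ if $3\le 2j+1\le\frac{k}{2}$; equals $m+2+j$ if $2j+1\ge\frac{k+2}{2}$. \end{enumerate}
   Context: For $n\ge 3$ and $1\le k<n/2$, the generalized Petersen graph $GP(n,k)$ has vertex set $\{u_i: i\in\mathbb{Z}_n\}\cup\{v_i: i\in\mathbb{Z}_n\}$ and edge set $\{u_iu_{i+1}: i\in\mathbb{Z}_n\}\cup\{v_iv_{i+k}: i\in\mathbb{Z}_n\}\cup\{u_iv_i: i\in\mathbb{Z}_n\}$ (indices mod $n$). ${\rm diam}(G)$ denotes the diameter (maximum shortest-path distance) of a connected graph $G$. -}

module Defs where

open import Data.Nat using (ℕ; zero; suc; _+_; _*_; _≤_; _<_)
open import Data.Nat.DivMod using (_mod_)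
open import Data.Fin using (Fin; toℕ)
open import Data.Bool using (Bool; true; false)
open import Data.Product using (_×_; _,_; ∃; ∃-syntax)
open import Data.Sum using (_⊎_)
open import Relation.Binary.PropositionalEquality using (_≡_)
open import Relation.Nullary using (¬_)

Even : ℕ → Set
Even k = ∃[ t ] k ≡ 2 * t

Odd : ℕ → Set
Odd k = ∃[ t ] k ≡ 1 + 2 * t

shift : ∀ {n} → ℕ → Fin n → Fin n
shift {suc n} s i = (toℕ i + s) mod (suc n)

-- Vertices of GP(n,k): (false , i) is u_i, (true , i) is v_i.
Vertex : ℕ → Set
Vertex n = Bool × Fin n

Adj : (n k : ℕ) → Vertex n → Vertex n → Set
Adj n k (false , i) (false , j) = j ≡ shift 1 i ⊎ i ≡ shift 1 j
Adj n k (true  , i) (true  , j) = j ≡ shift k i ⊎ i ≡ shift k j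
Adj n k (false , i) (true  , j) = i ≡ j
Adj n k (true  , i) (false , j) = i ≡ j

data Walk (n k : ℕ) : Vertex n → Vertex n → ℕ → Set where
  here : ∀ {x} → Walk n k x x 0
  step : ∀ {x y z d} → Adj n k x y → Walk n k y z d → Walk n k x z (suc d)

Dist : (n k : ℕ) → Vertex n → Vertex n → ℕ → Set
Dist n k x y d = Walk n k x y d × (∀ d′ → d′ < d → ¬ Walk n k x y d′)

Diam : (n k D : ℕ) → Set
Diam n k D =
  (∀ x y → ∃[ d ] (d ≤ D × Dist n k x y d)) × (∃[ x ] ∃[ y ] Dist n k x y D)

{-# OPTIONS --safe #-}
module Submission where

-- A walk from i to i + x + k y (mod n) that uses an inner step costs |x| + |y| plus its spokes,
-- two of which always suffice; so the diameter is 2 + W, where W is the largest value over i of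
-- w(i) = min {|x| + |y| : x + k y ≡ i (mod n)}, as long as the extremal i is too far away for
-- walks staying on the outer cycle.  Write n = q k + e with e < k.  If i = a k + r and
-- n − i = b k + s, then w(i) is the least of a + r, a + 1 + k − r, b + s and b + 1 + k − s: the
-- bounds on n make winding around the cycle more than once useless.  Either r + s = e and
-- a + b = q, where averaging a + r with b + s gives w(i) ≤ (q + e) / 2, or r + s = k + e and
-- a + b + 1 = q, where averaging the other two gives w(i) ≤ (q + 1 + k − e) / 2 (for e = 0 the
-- first two give (q + k − 1) / 2).  Splitting q and e, resp. q − 1 and k + e, into equal halves
-- attains these values, up to a parity correction when e = 1.  The cases of the theorem record
-- which of the bounds is the larger one.

open import Defs
open import Algebra.Properties.CommutativeSemigroup using (interchange)
open import Data.Bool.Base using (Bool; true; false; not; _∧_; if_then_else_) renaming (T to So)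
open import Data.Bool.Properties as Bool using (T-∧; T-≡)
open import Data.Empty using (⊥; ⊥-elim)
open import Data.Fin.Base using (Fin; toℕ; zero; suc; fromℕ<)
import Data.Fin.Properties as Fin
open import Data.Integer.Base as ℤ using (ℤ; -[1+_])
open import Data.List.Base as List using (List; []; _∷_; _++_)
open import Data.List.Relation.Unary.All using (All; []; _∷_)
open import Data.Nat.Base hiding (parity)
open import Data.Nat.DivMod
open import Data.Nat.Induction using (<-wellFounded; Acc; acc)
open import Data.Nat.Properties
open import Data.Product.Base using (Σ-syntax; _×_; _,_; ∃; ∃-syntax; proj₁; proj₂)
import Data.Product.Properties as Product
open import Data.Sum.Base as Sum using (_⊎_; inj₁; inj₂; [_,_]′)
open import Data.Vec.Base as Vec using (Vec; []; _∷_)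
open import Data.Vec.N-ary using (N-ary; _$ⁿ_)
open import Function.Base using (_|>_)
open import Function.Bundles using (Equivalence)
open import Relation.Binary.Definitions using (DecidableEquality)
open import Relation.Binary.PropositionalEquality hiding (_≗_)
open import Relation.Nullary
open import Relation.Nullary.Decidable using (map′; _⊎-dec_; _×-dec_)

-- Linear arithmetic over ℕ by Farkas certificates

infixl 7 _⊛_
infixl 6 _⊕_
infix 4 _≼_ _≗_
infix 3 ⊢_
infixr 2 _⇒_ _&_

data Expr (v : ℕ) : Set where
  var : Fin v → Expr v
  con : ℕ → Expr v
  _⊕_ : Expr v → Expr v → Expr v
  _⊛_ : ℕ → Expr v → Expr v

data Atom (v : ℕ) : Set where
  _≼_ _≗_ : Expr v → Expr v → Atom v

-- Conclusions joined by `&` share the hypotheses before them, so that one call yields a whole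
-- product of facts.
data Claim (v : ℕ) : Set where
  ⊢_  : Atom v → Claim v
  _⇒_ : Atom v → Claim v → Claim v
  _&_ : Atom v → Claim v → Claim v

module _ {v : ℕ} (ρ : Vec ℕ v) where

  ⟦_⟧ : Expr v → ℕ
  ⟦ var i ⟧ = Vec.lookup ρ i
  ⟦ con c ⟧ = c
  ⟦ x ⊕ y ⟧ = ⟦ x ⟧ + ⟦ y ⟧
  ⟦ c ⊛ x ⟧ = c * ⟦ x ⟧

  ⟦_⟧ᵃ : Atom v → Set
  ⟦ x ≼ y ⟧ᵃ = ⟦ x ⟧ ≤ ⟦ y ⟧
  ⟦ x ≗ y ⟧ᵃ = ⟦ x ⟧ ≡ ⟦ y ⟧

  ⟦_⟧ᶜ : Claim v → Set
  ⟦ ⊢ g ⟧ᶜ   = ⟦ g ⟧ᵃ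
  ⟦ h ⇒ c ⟧ᶜ = ⟦ h ⟧ᵃ → ⟦ c ⟧ᶜ
  ⟦ g & c ⟧ᶜ = ⟦ g ⟧ᵃ × ⟦ c ⟧ᶜ

unit : ∀ {v} → Fin v → Vec ℕ v
unit zero    = 1 ∷ Vec.replicate _ 0
unit (suc i) = 0 ∷ unit i

-- The constant term comes first.
coeffs : ∀ {v} → Expr v → Vec ℕ (suc v)
coeffs (var i) = 0 ∷ unit i
coeffs (con c) = c ∷ Vec.replicate _ 0
coeffs (x ⊕ y) = Vec.zipWith _+_ (coeffs x) (coeffs y)
coeffs (c ⊛ x) = Vec.map (c *_) (coeffs x)

_·_ : ∀ {v} → Vec ℕ v → Vec ℕ v → ℕ
[]       · []       = 0
(a ∷ as) · (x ∷ xs) = a * x + as · xs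

zero-· : ∀ {v} (ρ : Vec ℕ v) → Vec.replicate v 0 · ρ ≡ 0
zero-· []      = refl
zero-· (x ∷ ρ) = zero-· ρ

unit-· : ∀ {v} (i : Fin v) ρ → unit i · ρ ≡ Vec.lookup ρ i
unit-· zero    (x ∷ ρ) = trans (cong₂ _+_ (*-identityˡ x) (zero-· ρ)) (+-identityʳ x)
unit-· (suc i) (x ∷ ρ) = unit-· i ρ

+-· : ∀ {v} (as bs ρ : Vec ℕ v) → Vec.zipWith _+_ as bs · ρ ≡ as · ρ + bs · ρ
+-· []       []       []      = refl
+-· (a ∷ as) (b ∷ bs) (x ∷ ρ) rewrite +-· as bs ρ | *-distribʳ-+ x a b =
  interchange +-commutativeSemigroup (a * x) (b * x) (as · ρ) (bs · ρ)

*-· : ∀ {v} c (as ρ : Vec ℕ v) → Vec.map (c *_) as · ρ ≡ c * (as · ρ)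
*-· c []       []      = sym (*-zeroʳ c)
*-· c (a ∷ as) (x ∷ ρ) rewrite *-· c as ρ | *-assoc c a x = sym (*-distribˡ-+ c (a * x) (as · ρ))

coeffs-correct : ∀ {v} (ρ : Vec ℕ v) e → coeffs e · (1 ∷ ρ) ≡ ⟦_⟧ ρ e
coeffs-correct ρ (var i) = unit-· i ρ
coeffs-correct ρ (con c) rewrite zero-· ρ | *-identityʳ c = +-identityʳ c
coeffs-correct ρ (x ⊕ y) =
  trans (+-· (coeffs x) (coeffs y) (1 ∷ ρ)) (cong₂ _+_ (coeffs-correct ρ x) (coeffs-correct ρ y))
coeffs-correct ρ (c ⊛ x) =
  trans (*-· c (coeffs x) (1 ∷ ρ)) (cong (c *_) (coeffs-correct ρ x))

_≤ᵛ_ : ∀ {v} → Vec ℕ v → Vec ℕ v → Bool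
[]       ≤ᵛ []       = true
(a ∷ as) ≤ᵛ (b ∷ bs) = (a ≤ᵇ b) ∧ (as ≤ᵛ bs)

·-monoˡ : ∀ {v} (as bs ρ : Vec ℕ v) → So (as ≤ᵛ bs) → as · ρ ≤ bs · ρ
·-monoˡ []       []       []      _ = z≤n
·-monoˡ (a ∷ as) (b ∷ bs) (x ∷ ρ) p =
  let a≤b , as≤bs = Equivalence.to T-∧ p
  in +-mono-≤ (*-monoˡ-≤ x (≤ᵇ⇒≤ a b a≤b)) (·-monoˡ as bs ρ as≤bs)

Ineq : ℕ → Set
Ineq v = Expr v × Expr v

Holds : ∀ {v} → Vec ℕ v → Ineq v → Set
Holds ρ (x , y) = ⟦_⟧ ρ x ≤ ⟦_⟧ ρ y

addScaled : ∀ {v} → ℕ → Ineq v → Ineq v → Ineq v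
addScaled c (x , y) (x′ , y′) = c ⊛ x ⊕ x′ , c ⊛ y ⊕ y′

combine : ∀ {v} → List (Ineq v) → List ℕ → Ineq v
combine (h ∷ hs) (c ∷ cs) = addScaled c h (combine hs cs)
combine _        _        = con 0 , con 0

combine-holds : ∀ {v} {ρ : Vec ℕ v} {hs} → All (Holds ρ) hs → ∀ cs → Holds ρ (combine hs cs)
combine-holds []       cs       = z≤n
combine-holds (p ∷ ps) []       = z≤n
combine-holds (p ∷ ps) (c ∷ cs) = +-mono-≤ (*-monoʳ-≤ c p) (combine-holds ps cs)

-- Search for certificates

-- A constraint c + Σ aᵢ xᵢ ≤ 0, together with the multipliers that derive it.  Rows only serve
-- to find a certificate, which refutes then checks, so nothing about them is proved.
Row : Set
Row = ℤ × List ℤ × List ℕ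

toRow : ∀ {v} → Ineq v → List ℕ → Row
toRow (x , y) mult with Vec.zipWith ℤ._⊖_ (coeffs x) (coeffs y)
... | c ∷ as = c , Vec.toList as , mult

-- Here `pre` is a run of zeros, so that each row starts with its own unit vector of multipliers.
toRows : ∀ {v} → List (Ineq v) → List ℕ → List Row
toRows []       _   = []
toRows (h ∷ hs) pre = toRow h (pre ++ 1 ∷ []) ∷ toRows hs (pre ++ 0 ∷ [])

zipLong : List ℕ → List ℕ → List ℕ
zipLong []       ys       = ys
zipLong xs       []       = xs
zipLong (x ∷ xs) (y ∷ ys) = (x + y) ∷ zipLong xs ys

addRows : ℕ → Row → ℕ → Row → Row
addRows a (c , as , ms) b (d , bs , ns) =
    (ℤ.+ a ℤ.* c) ℤ.+ (ℤ.+ b ℤ.* d)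
  , List.zipWith (λ x y → (ℤ.+ a ℤ.* x) ℤ.+ (ℤ.+ b ℤ.* y)) as bs
  , zipLong (List.map (a *_) ms) (List.map (b *_) ns)

nonpositive : ℤ → Bool
nonpositive (ℤ.+ 0)     = true
nonpositive (ℤ.+ suc _) = false
nonpositive -[1+ _ ]    = true

-- Such a row holds for all natural values of the variables and cannot help a refutation.
trivial : Row → Bool
trivial (c , as , _) = nonpositive c ∧ List.foldr (λ a b → nonpositive a ∧ b) true as

prune : List Row → List Row
prune []       = []
prune (r ∷ rs) = if trivial r then prune rs else r ∷ prune rs

record Split : Set where
  constructor parts
  field kept : List Row
        pos neg : List (ℕ × Row)

-- Fourier–Motzkin elimination of the first variable; as it ranges over ℕ, a row in which its
-- coefficient is positive also survives without it.
addRow : ℤ → Row → Split → Split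
addRow (ℤ.+ 0)     r (parts k p n) = parts (r ∷ k) p n
addRow (ℤ.+ suc a) r (parts k p n) = parts (r ∷ k) ((suc a , r) ∷ p) n
addRow -[1+ a ]    r (parts k p n) = parts k p ((suc a , r) ∷ n)

splitRows : List Row → Split
splitRows []                       = parts [] [] []
-- Rows keep one coefficient per remaining variable, so this is only a default.
splitRows ((c , [] , ms) ∷ rs)     = splitRows rs
splitRows ((c , a ∷ as , ms) ∷ rs) = addRow a (c , as , ms) (splitRows rs)

resolve : Split → List Row
resolve (parts k p n) =
  k ++ List.concatMap (λ (a , r) → List.map (λ (b , s) → addRows b r a s) n) p

eliminate : List Row → List Row
eliminate rs = prune (resolve (splitRows rs))

search : ℕ → List Row → List ℕ
-- No contradiction was found; `refutes` rejects the empty certificate.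
search zero    []                         = []
search zero    ((ℤ.+ suc _ , _ , ms) ∷ _) = ms
search zero    (_ ∷ rs)                   = search zero rs
search (suc v) rs                         = search v (eliminate rs)

-- A combination x ≤ y is absurd once 1 + y is bounded by x coefficient by coefficient, as the
-- variables are nonnegative.
refutes : ∀ {v} → List (Ineq v) → List ℕ → Bool
refutes hs cs with combine hs cs
... | x , y = coeffs (con 1 ⊕ y) ≤ᵛ coeffs x

refutes-sound : ∀ {v} {ρ : Vec ℕ v} {hs} → All (Holds ρ) hs → ∀ cs → So (refutes hs cs) → ⊥
refutes-sound {ρ = ρ} {hs} ps cs ok with combine hs cs | combine-holds ps cs
... | x , y | x≤y = <-irrefl refl (≤-trans y<x x≤y)
  where
  y<x = subst₂ _≤_ (coeffs-correct ρ (con 1 ⊕ y)) (coeffs-correct ρ x)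
          (·-monoˡ (coeffs (con 1 ⊕ y)) (coeffs x) (1 ∷ ρ) ok)

inconsistent : ∀ {v} → List (Ineq v) → Bool
inconsistent {v} hs = refutes hs (search v (prune (toRows hs [])))

-- The negated goal 1 + y ≤ x joins the hypotheses to be refuted.
entails≤ : ∀ {v} → List (Ineq v) → Expr v → Expr v → Bool
entails≤ hs x y = inconsistent ((con 1 ⊕ y , x) ∷ hs)

entails : ∀ {v} → List (Ineq v) → Atom v → Bool
entails hs (x ≼ y) = entails≤ hs x y
entails hs (x ≗ y) = entails≤ hs x y ∧ entails≤ hs y x

decide : ∀ {v} → List (Ineq v) → Claim v → Bool
decide hs (⊢ g)       = entails hs g
decide hs (x ≼ y ⇒ c) = decide ((x , y) ∷ hs) c
decide hs (x ≗ y ⇒ c) = decide ((x , y) ∷ (y , x) ∷ hs) c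
decide hs (g & c)     = entails hs g ∧ decide hs c

entails≤-sound : ∀ {v} {ρ : Vec ℕ v} {hs} x y → All (Holds ρ) hs →
                 So (entails≤ hs x y) → ⟦_⟧ ρ x ≤ ⟦_⟧ ρ y
entails≤-sound {v} {hs = hs} x y ps ok =
  ≮⇒≥ (λ y<x → refutes-sound (y<x ∷ ps) (search v (prune (toRows ((con 1 ⊕ y , x) ∷ hs) []))) ok)

entails-sound : ∀ {v} {ρ : Vec ℕ v} {hs} → All (Holds ρ) hs → ∀ g → So (entails hs g) → ⟦_⟧ᵃ ρ g
entails-sound ps (x ≼ y) ok = entails≤-sound x y ps ok
entails-sound ps (x ≗ y) ok =
  let x≤y , y≤x = Equivalence.to T-∧ ok
  in ≤-antisym (entails≤-sound x y ps x≤y) (entails≤-sound y x ps y≤x)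

decide-sound : ∀ {v} (ρ : Vec ℕ v) {hs} → All (Holds ρ) hs → ∀ c → So (decide hs c) → ⟦_⟧ᶜ ρ c
decide-sound ρ ps (⊢ g)       ok     = entails-sound ps g ok
decide-sound ρ ps (x ≼ y ⇒ c) ok x≤y = decide-sound ρ (x≤y ∷ ps) c ok
decide-sound ρ ps (x ≗ y ⇒ c) ok x≡y = decide-sound ρ (≤-reflexive x≡y ∷ ≤-reflexive (sym x≡y) ∷ ps) c ok
decide-sound ρ ps (g & c)     ok     =
  let okᵍ , okᶜ = Equivalence.to T-∧ ok in entails-sound ps g okᵍ , decide-sound ρ ps c okᶜ

-- The entries of `ρ` may be any terms: a product such as `a * k` counts as one more variable, and
-- nonlinear facts about it are passed as hypotheses. The argument `refl` runs the search during
-- type checking.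
linear : ∀ {v} (ρ : Vec ℕ v) (f : N-ary v (Expr v) (Claim v)) →
         let c = f $ⁿ Vec.map var (Vec.allFin v) in decide [] c ≡ true → ⟦_⟧ᶜ ρ c
linear {v} ρ f ok = decide-sound ρ [] (f $ⁿ Vec.map var (Vec.allFin v)) (Equivalence.from T-≡ ok)

-- Walks in the generalized Petersen graph

module _ {n : ℕ} .{{_ : NonZero n}} where

  toℕ-shift : ∀ s (i : Fin n) → toℕ (shift s i) ≡ (toℕ i + s) % n
  -- `shift` computes only once `n` is a successor, so `n` is generalised together with its
  -- instance.
  toℕ-shift = go n
    where
    go : ∀ n .{{_ : NonZero n}} s (i : Fin n) → toℕ (shift s i) ≡ (toℕ i + s) % n
    go (suc n) s i = Fin.toℕ-fromℕ< (m%n<n (toℕ i + s) (suc n))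

  [m%n+o]%n≡[m+o]%n : ∀ m o → (m % n + o) % n ≡ (m + o) % n
  [m%n+o]%n≡[m+o]%n m o = begin
    (m % n + o) % n          ≡⟨ %-distribˡ-+ (m % n) o n ⟩
    (m % n % n + o % n) % n  ≡⟨ cong (λ x → (x + o % n) % n) (m%n%n≡m%n m n) ⟩
    (m % n + o % n) % n      ≡⟨ %-distribˡ-+ m o n ⟨
    (m + o) % n              ∎
    where open ≡-Reasoning

  shift-shift : ∀ s t (i : Fin n) → shift t (shift s i) ≡ shift (s + t) i
  shift-shift s t i = Fin.toℕ-injective (begin
    toℕ (shift t (shift s i))    ≡⟨ toℕ-shift t (shift s i) ⟩
    (toℕ (shift s i) + t) % n    ≡⟨ cong (λ x → (x + t) % n) (toℕ-shift s i) ⟩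
    ((toℕ i + s) % n + t) % n    ≡⟨ [m%n+o]%n≡[m+o]%n (toℕ i + s) t ⟩
    (toℕ i + s + t) % n          ≡⟨ cong (_% n) (+-assoc (toℕ i) s t) ⟩
    (toℕ i + (s + t)) % n        ≡⟨ toℕ-shift (s + t) i ⟨
    toℕ (shift (s + t) i)        ∎)
    where open ≡-Reasoning

  shift-periodic : ∀ s w (i : Fin n) → shift (s + w * n) i ≡ shift s i
  shift-periodic s w i = Fin.toℕ-injective (begin
    toℕ (shift (s + w * n) i)    ≡⟨ toℕ-shift (s + w * n) i ⟩
    (toℕ i + (s + w * n)) % n    ≡⟨ cong (_% n) (+-assoc (toℕ i) s (w * n)) ⟨
    (toℕ i + s + w * n) % n      ≡⟨ [m+kn]%n≡m%n (toℕ i + s) w n ⟩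
    (toℕ i + s) % n              ≡⟨ toℕ-shift s i ⟨
    toℕ (shift s i)              ∎)
    where open ≡-Reasoning

  shift-zero : (i : Fin n) → shift 0 i ≡ i
  shift-zero i = Fin.toℕ-injective (begin
    toℕ (shift 0 i)   ≡⟨ toℕ-shift 0 i ⟩
    (toℕ i + 0) % n   ≡⟨ cong (_% n) (+-identityʳ (toℕ i)) ⟩
    toℕ i % n         ≡⟨ m<n⇒m%n≡m (Fin.toℕ<n i) ⟩
    toℕ i             ∎)
    where open ≡-Reasoning

  shift-transitive : (i j : Fin n) → ∃[ s ] s < n × j ≡ shift s i
  shift-transitive i j = s % n , m%n<n s n , Fin.toℕ-injective (begin
    toℕ j                       ≡⟨ m<n⇒m%n≡m (Fin.toℕ<n j) ⟨
    toℕ j % n                   ≡⟨ [m+n]%n≡m%n (toℕ j) n ⟨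
    (toℕ j + n) % n             ≡⟨ cong (λ x → (toℕ j + x) % n) (m∸n+n≡m (<⇒≤ (Fin.toℕ<n i))) ⟨
    (toℕ j + (n ∸ toℕ i + toℕ i)) % n
                                ≡⟨ cong (_% n) (+-assoc (toℕ j) (n ∸ toℕ i) (toℕ i)) ⟨
    (s + toℕ i) % n             ≡⟨ [m%n+o]%n≡[m+o]%n s (toℕ i) ⟨
    (s % n + toℕ i) % n         ≡⟨ cong (_% n) (+-comm (s % n) (toℕ i)) ⟩
    (toℕ i + s % n) % n         ≡⟨ toℕ-shift (s % n) i ⟨
    toℕ (shift (s % n) i)       ∎)
    where
    open ≡-Reasoning
    -- The difference j - i, kept natural by adding n.
    s = toℕ j + (n ∸ toℕ i)

  toℕ+≡shift+ : ∀ s (i : Fin n) → ∃[ w ] toℕ i + s ≡ toℕ (shift s i) + w * n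
  toℕ+≡shift+ s i = (toℕ i + s) / n ,
    trans (m≡m%n+[m/n]*n (toℕ i + s) n) (cong (_+ (toℕ i + s) / n * n) (sym (toℕ-shift s i)))

Adj-sym : ∀ {n k} (x y : Vertex n) → Adj n k x y → Adj n k y x
Adj-sym (false , _) (false , _) = Sum.swap
Adj-sym (true  , _) (true  , _) = Sum.swap
Adj-sym (false , _) (true  , _) = sym
Adj-sym (true  , _) (false , _) = sym

module _ {n k : ℕ} where

  _++ʷ_ : ∀ {x y z c d} → Walk n k x y c → Walk n k y z d → Walk n k x z (c + d)
  here     ++ʷ v = v
  step a w ++ʷ v = step a (w ++ʷ v)

  snoc : ∀ {x y z d} → Walk n k x y d → Adj n k y z → Walk n k x z (suc d)
  snoc here       a = step a here
  snoc (step b w) a = step b (snoc w a)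

  reverse : ∀ {x y d} → Walk n k x y d → Walk n k y x d
  reverse here                       = here
  reverse (step {x = x} {y = y} a w) = snoc (reverse w) (Adj-sym x y a)

  module _ .{{_ : NonZero n}} where

    stride : Bool → ℕ
    stride false = 1
    stride true  = k

    Translates : Bool → ℕ → ℕ → Set
    Translates b s d = ∀ i → Walk n k (b , i) (b , shift s i) d

    Adj-shift : ∀ b i → Adj n k (b , i) (b , shift (stride b) i)
    Adj-shift false i = inj₁ refl
    Adj-shift true  i = inj₁ refl

    forward : ∀ b x → Translates b (x * stride b) x
    forward b zero    i = subst (λ j → Walk n k (b , i) (b , j) 0) (sym (shift-zero i)) here
    forward b (suc x) i =
      subst (λ j → Walk n k (b , i) (b , j) (suc x)) (shift-shift (stride b) (x * stride b) i)
        (step (Adj-shift b i) (forward b x (shift (stride b) i)))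

    -- Since s is minus x strides modulo n, x forward steps from `shift s i` lead back to `i`; the
    -- walk sought is their reverse.
    backward : ∀ b x s w → s + x * stride b ≡ w * n → Translates b s x
    backward b x s w eq i =
      reverse (subst (λ j → Walk n k (b , shift s i) (b , j) x) closes (forward b x (shift s i)))
      where
      closes : shift (x * stride b) (shift s i) ≡ i
      closes = begin
        shift (x * stride b) (shift s i)  ≡⟨ shift-shift s (x * stride b) i ⟩
        shift (s + x * stride b) i        ≡⟨ cong (λ t → shift t i) eq ⟩
        shift (w * n) i                   ≡⟨ shift-periodic 0 w i ⟩
        shift 0 i                         ≡⟨ shift-zero i ⟩
        i                                 ∎
        where open ≡-Reasoning

    -- One spoke suffices between different cycles and two on the same cycle. From inner to outer
    -- the inner leg comes first, which is harmless because shifts commute.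
    translate : ∀ {s t x y} → Translates false s x → Translates true t y → ∀ b c i →
                ∃[ d ] d ≤ 2 + (x + y) × Walk n k (b , i) (c , shift (s + t) i) d
    translate {s} {t} {x} {y} outer inner b c i =
      let d , d≤ , w = walk b c
      in d , d≤ , subst (λ j → Walk n k (b , i) (c , j) d) (shift-shift s t i) w
      where
      spoke : ∀ b j → Walk n k (b , j) (not b , j) 1
      spoke false j = step refl here
      spoke true  j = step refl here
      outer-inner = outer i ++ʷ (spoke false _ ++ʷ inner (shift s i))
      inner-outer = inner i ++ʷ (spoke true _ ++ʷ outer (shift t i))
      swap : shift s (shift t i) ≡ shift t (shift s i)
      swap = trans (shift-shift t s i) (trans (cong (λ u → shift u i) (+-comm t s)) (sym (shift-shift s t i)))
      walk : ∀ b c → ∃[ d ] d ≤ 2 + (x + y) × Walk n k (b , i) (c , shift t (shift s i)) d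
      walk false true  = _ , linear (x ∷ y ∷ []) (λ x y → ⊢ x ⊕ (con 1 ⊕ y) ≼ con 2 ⊕ (x ⊕ y)) refl , outer-inner
      walk false false = _ , linear (x ∷ y ∷ []) (λ x y → ⊢ x ⊕ (con 1 ⊕ y) ⊕ con 1 ≼ con 2 ⊕ (x ⊕ y)) refl
                           , outer-inner ++ʷ spoke true _
      walk true  true  = _ , linear (x ∷ y ∷ []) (λ x y → ⊢ con 1 ⊕ (x ⊕ (con 1 ⊕ y)) ≼ con 2 ⊕ (x ⊕ y)) refl
                           , spoke true i ++ʷ outer-inner
      walk true  false = _ , linear (x ∷ y ∷ []) (λ x y → ⊢ y ⊕ (con 1 ⊕ x) ≼ con 2 ⊕ (x ⊕ y)) refl
                           , subst (λ j → Walk n k (true , i) (false , j) _) swap inner-outer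

  _≟ⱽ_ : DecidableEquality (Vertex n)
  _≟ⱽ_ = Product.≡-dec Bool._≟_ Fin._≟_

  Adj? : ∀ x y → Dec (Adj n k x y)
  Adj? (false , i) (false , j) = (j Fin.≟ shift 1 i) ⊎-dec (i Fin.≟ shift 1 j)
  Adj? (true  , i) (true  , j) = (j Fin.≟ shift k i) ⊎-dec (i Fin.≟ shift k j)
  Adj? (false , i) (true  , j) = i Fin.≟ j
  Adj? (true  , i) (false , j) = i Fin.≟ j

  anyVertex? : ∀ {P : Vertex n → Set} → (∀ x → Dec (P x)) → Dec (∃ P)
  anyVertex? P? = map′ [ (λ (i , p) → (false , i) , p) , (λ (i , p) → (true , i) , p) ]′
                       (λ { ((false , i) , p) → inj₁ (i , p) ; ((true , i) , p) → inj₂ (i , p) })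
                       (Fin.any? (λ i → P? (false , i)) ⊎-dec Fin.any? (λ i → P? (true , i)))

  Walk? : ∀ x y d → Dec (Walk n k x y d)
  Walk? x y zero    = map′ (λ { refl → here }) (λ { here → refl }) (x ≟ⱽ y)
  Walk? x y (suc d) = map′ (λ (_ , a , w) → step a w) (λ { (step a w) → _ , a , w })
                           (anyVertex? (λ z → Adj? x z ×-dec Walk? z y d))

  -- Whether a walk of given length exists is decidable in a finite graph, so well-founded descent
  -- reaches the least length.
  shortest : ∀ {x y d} → Walk n k x y d → ∃[ e ] e ≤ d × Dist n k x y e
  shortest {x} {y} {d} w = go d (<-wellFounded d) w
    where
    go : ∀ d → Acc _<_ d → Walk n k x y d → ∃[ e ] e ≤ d × Dist n k x y e
    go d (acc rec) w with anyUpTo? (Walk? x y) d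
    ... | yes (c , c<d , v) = let e , e≤c , dist = go c (rec c<d) v in e , ≤-trans e≤c (<⇒≤ c<d) , dist
    ... | no ¬shorter       = d , ≤-refl , w , λ c c<d v → ¬shorter (c , c<d , v)

-- Lower bound: displacement and cost of a walk

-- Net effect of a walk from index p to index q: X, X′ count the outer steps forwards and
-- backwards, Y, Y′ the inner ones, and T, T′ the reductions modulo n.
record Offset (n k p q : ℕ) : Set where
  constructor offset
  field
    X X′ Y Y′ T T′ : ℕ
    balance : p + X + Y * k + T * n ≡ q + X′ + Y′ * k + T′ * n

  inner cost : ℕ
  inner = Y + Y′
  cost  = X + X′ + inner

module _ {n k : ℕ} where

  open Offset

  -- Prepending a step raises one counter, and the w reductions modulo n join `T′` for a forward
  -- step and `T` for a backward one. Outer steps also preserve `inner`, which later identifies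
  -- walks confined to the outer cycle.
  outer⁺ : ∀ {p r q} w → p + 1 ≡ r + w * n → (o : Offset n k r q) →
           Σ[ o′ ∈ Offset n k p q ] inner o′ ≡ inner o × cost o′ ≡ suc (cost o)
  outer⁺ {p} {r} {q} w wrap (offset X X′ Y Y′ T T′ eq) = offset (suc X) X′ Y Y′ T (w + T′)
    (trans (linear (p ∷ r ∷ X ∷ Y * k ∷ T * n ∷ q ∷ X′ ∷ Y′ * k ∷ T′ * n ∷ w * n ∷ [])
              (λ p r X Y T q X′ Y′ T′ w → p ⊕ con 1 ≗ r ⊕ w ⇒ r ⊕ X ⊕ Y ⊕ T ≗ q ⊕ X′ ⊕ Y′ ⊕ T′ ⇒
                ⊢ p ⊕ (con 1 ⊕ X) ⊕ Y ⊕ T ≗ q ⊕ X′ ⊕ Y′ ⊕ (w ⊕ T′)) refl wrap eq)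
           (cong (q + X′ + Y′ * k +_) (sym (*-distribʳ-+ n w T′)))) ,
    refl , refl

  outer⁻ : ∀ {p r q} w → r + 1 ≡ p + w * n → (o : Offset n k r q) →
           Σ[ o′ ∈ Offset n k p q ] inner o′ ≡ inner o × cost o′ ≡ suc (cost o)
  outer⁻ {p} {r} {q} w wrap (offset X X′ Y Y′ T T′ eq) = offset X (suc X′) Y Y′ (w + T) T′
    (trans (cong (p + X + Y * k +_) (*-distribʳ-+ n w T))
           (linear (p ∷ r ∷ X ∷ Y * k ∷ T * n ∷ q ∷ X′ ∷ Y′ * k ∷ T′ * n ∷ w * n ∷ [])
              (λ p r X Y T q X′ Y′ T′ w → r ⊕ con 1 ≗ p ⊕ w ⇒ r ⊕ X ⊕ Y ⊕ T ≗ q ⊕ X′ ⊕ Y′ ⊕ T′ ⇒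
                ⊢ p ⊕ X ⊕ Y ⊕ (w ⊕ T) ≗ q ⊕ (con 1 ⊕ X′) ⊕ Y′ ⊕ T′) refl wrap eq)) ,
    refl , cong (_+ (Y + Y′)) (+-suc X X′)

  inner⁺ : ∀ {p r q} w → p + k ≡ r + w * n → (o : Offset n k r q) →
           Σ[ o′ ∈ Offset n k p q ] cost o′ ≡ suc (cost o)
  inner⁺ {p} {r} {q} w wrap (offset X X′ Y Y′ T T′ eq) = offset X X′ (suc Y) Y′ T (w + T′)
    (trans (linear (p ∷ r ∷ X ∷ Y * k ∷ T * n ∷ q ∷ X′ ∷ Y′ * k ∷ T′ * n ∷ w * n ∷ k ∷ [])
              (λ p r X Y T q X′ Y′ T′ w k → p ⊕ k ≗ r ⊕ w ⇒ r ⊕ X ⊕ Y ⊕ T ≗ q ⊕ X′ ⊕ Y′ ⊕ T′ ⇒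
                ⊢ p ⊕ X ⊕ (k ⊕ Y) ⊕ T ≗ q ⊕ X′ ⊕ Y′ ⊕ (w ⊕ T′)) refl wrap eq)
           (cong (q + X′ + Y′ * k +_) (sym (*-distribʳ-+ n w T′)))) ,
    +-suc (X + X′) (Y + Y′)

  inner⁻ : ∀ {p r q} w → r + k ≡ p + w * n → (o : Offset n k r q) →
           Σ[ o′ ∈ Offset n k p q ] cost o′ ≡ suc (cost o)
  inner⁻ {p} {r} {q} w wrap (offset X X′ Y Y′ T T′ eq) = offset X X′ Y (suc Y′) (w + T) T′
    (trans (cong (p + X + Y * k +_) (*-distribʳ-+ n w T))
           (linear (p ∷ r ∷ X ∷ Y * k ∷ T * n ∷ q ∷ X′ ∷ Y′ * k ∷ T′ * n ∷ w * n ∷ k ∷ [])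
              (λ p r X Y T q X′ Y′ T′ w k → r ⊕ k ≗ p ⊕ w ⇒ r ⊕ X ⊕ Y ⊕ T ≗ q ⊕ X′ ⊕ Y′ ⊕ T′ ⇒
                ⊢ p ⊕ X ⊕ Y ⊕ (w ⊕ T) ≗ q ⊕ X′ ⊕ (k ⊕ Y′) ⊕ T′) refl wrap eq)) ,
    linear (X ∷ X′ ∷ Y ∷ Y′ ∷ [])
      (λ X X′ Y Y′ → ⊢ X ⊕ X′ ⊕ (Y ⊕ (con 1 ⊕ Y′)) ≗ con 1 ⊕ (X ⊕ X′ ⊕ (Y ⊕ Y′))) refl

  module _ .{{_ : NonZero n}} where

    outer-move : ∀ {i l : Fin n} {q} → l ≡ shift 1 i ⊎ i ≡ shift 1 l → (o : Offset n k (toℕ l) q) →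
                 Σ[ o′ ∈ Offset n k (toℕ i) q ] inner o′ ≡ inner o × cost o′ ≡ suc (cost o)
    outer-move {i} (inj₁ refl) o = let t , wrap = toℕ+≡shift+ 1 i in outer⁺ t wrap o
    outer-move {l = l} (inj₂ refl) o = let t , wrap = toℕ+≡shift+ 1 l in outer⁻ t wrap o

    inner-move : ∀ {i l : Fin n} {q} → l ≡ shift k i ⊎ i ≡ shift k l → (o : Offset n k (toℕ l) q) →
                 Σ[ o′ ∈ Offset n k (toℕ i) q ] cost o′ ≡ suc (cost o)
    inner-move {i} (inj₁ refl) o = let t , wrap = toℕ+≡shift+ k i in inner⁺ t wrap o
    inner-move {l = l} (inj₂ refl) o = let t , wrap = toℕ+≡shift+ k l in inner⁻ t wrap o

    -- A walk between outer vertices either stays on the outer cycle or leaves and re-enters it,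
    -- paying for two spokes; from an inner vertex at least one spoke is due.
    outer-offset : ∀ {i j d} → Walk n k (false , i) (false , j) d →
      Σ[ o ∈ Offset n k (toℕ i) (toℕ j) ] (inner o ≡ 0 × cost o ≤ d ⊎ 2 + cost o ≤ d)
    inner-offset : ∀ {i j d} → Walk n k (true , i) (false , j) d →
      Σ[ o ∈ Offset n k (toℕ i) (toℕ j) ] 1 + cost o ≤ d

    outer-offset here = offset 0 0 0 0 0 0 refl , inj₁ (refl , z≤n)
    outer-offset (step {x = _ , i} {y = false , l} adj w) =
      let o , bound = outer-offset w
          o′ , inner≡ , cost≡ = outer-move adj o
      in o′ , Sum.map (λ (flat , c≤d) → trans inner≡ flat , ≤-trans (≤-reflexive cost≡) (s≤s c≤d))
                      (λ c≤d → ≤-trans (≤-reflexive (cong (2 +_) cost≡)) (s≤s c≤d)) bound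
    outer-offset (step {y = true , _} refl w) = let o , c≤d = inner-offset w in o , inj₂ (s≤s c≤d)

    inner-offset (step {x = _ , i} {y = true , l} adj w) =
      let o , c≤d = inner-offset w
          o′ , cost≡ = inner-move adj o
      in o′ , ≤-trans (≤-reflexive (cong suc cost≡)) (s≤s c≤d)
    inner-offset (step {y = false , _} refl w) with outer-offset w
    ... | o , inj₁ (_ , c≤d)  = o , s≤s c≤d
    ... | o , inj₂ c+2≤d      = o , m≤n⇒m≤1+n (≤-trans (n≤1+n _) c+2≤d)

-- The two cheapest ways of covering a k + r, by a or by a + 1 inner steps, cost a + r and
-- a + 1 + k − r; wrap handles walks that cover at least n + a k + r instead, and outer those
-- without inner steps.
record Long (n k W a r : ℕ) : Set where
  field
    r≤k   : r ≤ k
    low   : W ≤ a + r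
    high  : W + r ≤ a + 1 + k
    wrap  : W * k < n + (a * k + r) + k
    outer : 2 + W ≤ a * k + r

module _ {n k W a r : ℕ} .{{_ : NonZero k}} (long : Long n k W a r) where

  open Long long

  -- Compare the net number Y - Y′ of inner steps with a. If it falls short by δ, outer steps must
  -- cover r + δ k, which is at least r + δ. If it exceeds a, outer steps must undo an overshoot of
  -- at least k - r.
  unwrapped-cost : ∀ X X′ Y Y′ → X + Y * k ≡ a * k + r + X′ + Y′ * k → W ≤ X + X′ + (Y + Y′)
  unwrapped-cost X X′ Y Y′ eq with ≤-<-connex Y (a + Y′)
  ... | inj₁ Y≤ with m≤n⇒∃[o]m+o≡n Y≤
  ... | δ , Y+δ≡ =
    linear (X ∷ X′ ∷ Y ∷ Y′ ∷ W ∷ a ∷ r ∷ δ ∷ Y * k ∷ a * k ∷ Y′ * k ∷ δ * k ∷ [])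
      (λ X X′ Y Y′ W a r δ Yk ak Y′k δk →
        X ⊕ Yk ≗ ak ⊕ r ⊕ X′ ⊕ Y′k ⇒ Yk ⊕ δk ≗ ak ⊕ Y′k ⇒ δ ≼ δk ⇒ Y ⊕ δ ≗ a ⊕ Y′ ⇒ W ≼ a ⊕ r ⇒
        ⊢ W ≼ X ⊕ X′ ⊕ (Y ⊕ Y′)) refl
      eq (trans (sym (*-distribʳ-+ k Y δ)) (trans (cong (_* k) Y+δ≡) (*-distribʳ-+ k a Y′)))
      (m≤m*n δ k) Y+δ≡ low
  unwrapped-cost X X′ Y Y′ eq | inj₂ Y> with m≤n⇒∃[o]m+o≡n Y>
  ... | δ , refl =
    linear (X ∷ X′ ∷ Y′ ∷ W ∷ a ∷ r ∷ δ ∷ k ∷ a * k ∷ Y′ * k ∷ δ * k ∷ [])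
      (λ X X′ Y′ W a r δ k ak Y′k δk →
        X ⊕ (k ⊕ (ak ⊕ Y′k ⊕ δk)) ≗ ak ⊕ r ⊕ X′ ⊕ Y′k ⇒ W ⊕ r ≼ a ⊕ con 1 ⊕ k ⇒
        ⊢ W ≼ X ⊕ X′ ⊕ (con 1 ⊕ (a ⊕ Y′ ⊕ δ) ⊕ Y′)) refl
      (trans (cong (λ z → X + (k + z)) (sym distrib)) eq) high
    where
    distrib : (a + Y′ + δ) * k ≡ a * k + Y′ * k + δ * k
    distrib = trans (*-distribʳ-+ k (a + Y′) δ) (cong (_+ δ * k) (*-distribʳ-+ k a Y′))

  -- No step advances by more than k, so (X + Y) k is at least n + a k + r; with `wrap` this gives W
  -- k < (X + Y + 1) k.
  wrapped-cost : ∀ t X X′ Y Y′ → X + Y * k ≡ a * k + r + X′ + Y′ * k + suc t * n →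
                 W ≤ X + X′ + (Y + Y′)
  wrapped-cost t X X′ Y Y′ eq =
    linear (W ∷ X ∷ X′ ∷ Y ∷ Y′ ∷ [])
      (λ W X X′ Y Y′ → con 1 ⊕ W ≼ con 1 ⊕ (X ⊕ Y) ⇒ ⊢ W ≼ X ⊕ X′ ⊕ (Y ⊕ Y′)) refl
      (*-cancelʳ-< k W (suc (X + Y)) (≤-trans wrap
        (linear (X ∷ X * k ∷ X′ ∷ Y * k ∷ Y′ * k ∷ a * k ∷ r ∷ n ∷ t * n ∷ k ∷ (X + Y) * k ∷ [])
          (λ X Xk X′ Yk Y′k ak r n tn k XYk →
            X ⊕ Yk ≗ ak ⊕ r ⊕ X′ ⊕ Y′k ⊕ (n ⊕ tn) ⇒ X ≼ Xk ⇒ XYk ≗ Xk ⊕ Yk ⇒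
            ⊢ n ⊕ (ak ⊕ r) ⊕ k ≼ k ⊕ XYk) refl
          eq (m≤m*n X k) (*-distribʳ-+ k X Y))))

  long-cost : ∀ t X X′ Y Y′ → X + Y * k ≡ a * k + r + X′ + Y′ * k + t * n →
              (W ≤ X + X′ + (Y + Y′)) × (Y + Y′ ≡ 0 → 2 + W ≤ X + X′ + (Y + Y′))
  long-cost t X X′ Y Y′ eq = any t eq , flat Y Y′ eq
    where
    any : ∀ t → X + Y * k ≡ a * k + r + X′ + Y′ * k + t * n → W ≤ X + X′ + (Y + Y′)
    any zero    eq = unwrapped-cost X X′ Y Y′ (trans eq (+-identityʳ _))
    any (suc t) eq = wrapped-cost t X X′ Y Y′ eq
    flat : ∀ Y Y′ → X + Y * k ≡ a * k + r + X′ + Y′ * k + t * n →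
           Y + Y′ ≡ 0 → 2 + W ≤ X + X′ + (Y + Y′)
    flat zero zero eq _ =
      linear (X ∷ X′ ∷ a * k ∷ r ∷ t * n ∷ W ∷ [])
        (λ X X′ ak r tn W → X ⊕ con 0 ≗ ak ⊕ r ⊕ X′ ⊕ con 0 ⊕ tn ⇒ con 2 ⊕ W ≼ ak ⊕ r ⇒
          ⊢ con 2 ⊕ W ≼ X ⊕ X′ ⊕ con 0) refl eq outer

module _ {n k W a r b s : ℕ} .{{_ : NonZero k}}
         (split : n ≡ a * k + r + (b * k + s)) (out : Long n k W a r) (back : Long n k W b s) where

  open Offset

  -- The sign of T′ - T tells the direction of travel. If T ≤ T′, the walk covers a k + r + (T′ - T)
  -- n forwards; otherwise it covers b k + s + (T - T′ - 1) n backwards, and exchanging forward and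
  -- backward counts leads to the same estimate for b and s.
  offset-cost : (o : Offset n k 0 (a * k + r)) →
                (W ≤ cost o) × (inner o ≡ 0 → 2 + W ≤ cost o)
  offset-cost (offset X X′ Y Y′ T T′ eq) with ≤-<-connex T T′
  ... | inj₁ T≤T′ with m≤n⇒∃[o]m+o≡n T≤T′
  ... | t , refl = long-cost out t X X′ Y Y′
    (linear (X ∷ X′ ∷ Y * k ∷ Y′ * k ∷ T * n ∷ t * n ∷ (T + t) * n ∷ a * k ∷ r ∷ [])
      (λ X X′ Yk Y′k Tn tn Ttn ak r → X ⊕ Yk ⊕ Tn ≗ ak ⊕ r ⊕ X′ ⊕ Y′k ⊕ Ttn ⇒ Ttn ≗ Tn ⊕ tn ⇒
        ⊢ X ⊕ Yk ≗ ak ⊕ r ⊕ X′ ⊕ Y′k ⊕ tn) refl eq (*-distribʳ-+ n T t))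
  offset-cost (offset X X′ Y Y′ T T′ eq) | inj₂ T>T′ with m≤n⇒∃[o]m+o≡n T>T′
  ... | t , refl = let all , flat = long-cost back t X′ X Y′ Y rearranged
    in ≤-trans all (≤-reflexive swap) ,
       λ Y+Y′≡0 → ≤-trans (flat (trans (+-comm Y′ Y) Y+Y′≡0)) (≤-reflexive swap)
    where
    swap : X′ + X + (Y′ + Y) ≡ X + X′ + (Y + Y′)
    swap = cong₂ _+_ (+-comm X′ X) (+-comm Y′ Y)
    rearranged : X′ + Y′ * k ≡ b * k + s + X + Y * k + t * n
    rearranged =
      linear (X ∷ X′ ∷ Y * k ∷ Y′ * k ∷ T′ * n ∷ t * n ∷ (T′ + t) * n ∷ a * k ∷ r ∷ b * k ∷ s ∷ n ∷ [])
        (λ X X′ Yk Y′k T′n tn T′tn ak r bk s n →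
          X ⊕ Yk ⊕ (n ⊕ T′tn) ≗ ak ⊕ r ⊕ X′ ⊕ Y′k ⊕ T′n ⇒ T′tn ≗ T′n ⊕ tn ⇒ n ≗ ak ⊕ r ⊕ (bk ⊕ s) ⇒
          ⊢ X′ ⊕ Y′k ≗ bk ⊕ s ⊕ X ⊕ Yk ⊕ tn) refl eq (*-distribʳ-+ n T′ t) split

  walk-length : .{{_ : NonZero n}} → ∀ {i j d} → toℕ i ≡ 0 → toℕ j ≡ a * k + r →
                Walk n k (false , i) (false , j) d → 2 + W ≤ d
  walk-length i≡0 j≡ w with outer-offset w
  ... | o , bound rewrite i≡0 | j≡ with bound
  ... | inj₁ (flat , c≤d) = ≤-trans (proj₂ (offset-cost o) flat) c≤d
  ... | inj₂ c≤d          = ≤-trans (+-monoʳ-≤ 2 (proj₁ (offset-cost o))) c≤d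

-- Upper bound: explicit walks

-- One of the four costs a + r, a + 1 + k - r, b + s, b + 1 + k - s is at most W, written without
-- subtraction.
Short : (n k W : ℕ) → Set
Short n k W = ∀ a r b s → r < k → s < k → a * k + r + (b * k + s) ≡ n →
              (a + r ≤ W ⊎ a + 1 + k ≤ W + r) ⊎ (b + s ≤ W ⊎ b + 1 + k ≤ W + s)

module _ {n k W : ℕ} .{{_ : NonZero n}} .{{_ : NonZero k}} (k≤n : k ≤ n) (short : Short n k W) where

  connected : ∀ x y → ∃[ d ] d ≤ 2 + W × Walk n k x y d
  connected (b , i) (c , j) with shift-transitive i j
  ... | p , p<n , refl = go (short _ _ _ _ (m%n<n p k) (m%n<n (n ∸ p) k) whole)
    where
    r = p % k
    a = p / k
    s = (n ∸ p) % k
    d = (n ∸ p) / k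
    p≡ : p ≡ a * k + r
    p≡ = trans (m≡m%n+[m/n]*n p k) (+-comm r (a * k))
    n∸p≡ : n ∸ p ≡ d * k + s
    n∸p≡ = trans (m≡m%n+[m/n]*n (n ∸ p) k) (+-comm s (d * k))
    whole : a * k + r + (d * k + s) ≡ n
    whole = trans (cong₂ _+_ (sym p≡) (sym n∸p≡)) (m+[n∸m]≡n (<⇒≤ p<n))
    -- A backward leg is represented by a complementary natural shift, so the total exceeds p by w
    -- multiples of n.
    via : ∀ {u v x y} w → Translates {n} {k} false u x → Translates {n} {k} true v y → u + v ≡ p + w * n →
          x + y ≤ W → ∃[ e ] e ≤ 2 + W × Walk n k (b , i) (c , shift p i) e
    via {u} {v} w out inn u+v≡ x+y≤ =
      let e , e≤ , walk = translate out inn b c i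
      in e , ≤-trans e≤ (+-monoʳ-≤ 2 x+y≤) ,
         subst (λ l → Walk n k (b , i) (c , l) e)
           (trans (cong (λ t → shift t i) u+v≡) (shift-periodic p w i)) walk
    go : (a + r ≤ W ⊎ a + 1 + k ≤ W + r) ⊎ (d + s ≤ W ⊎ d + 1 + k ≤ W + s) →
         ∃[ e ] e ≤ 2 + W × Walk n k (b , i) (c , shift p i) e
    go (inj₁ (inj₁ a+r≤W)) = via 0 (forward false r) (forward true a)
      (linear (r * 1 ∷ r ∷ a * k ∷ p ∷ [])
        (λ r1 r ak p → r1 ≗ r ⇒ p ≗ ak ⊕ r ⇒ ⊢ r1 ⊕ ak ≗ p ⊕ con 0) refl (*-identityʳ r) p≡)
      (≤-trans (≤-reflexive (+-comm r a)) a+r≤W)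
    -- Overshoot with a + 1 inner steps, then return by x = k - r outer steps.
    go (inj₁ (inj₂ a+1+k≤W+r)) with m≤n⇒∃[o]m+o≡n (m%n≤n p k)
    ... | x , r+x≡k with m≤n⇒∃[o]m+o≡n (≤-trans (m≤n+m x r) (≤-trans (≤-reflexive r+x≡k) k≤n))
    ... | u , x+u≡n = via 1
      (backward false x u 1
        (linear (u ∷ x * 1 ∷ x ∷ n ∷ [])
          (λ u x1 x n → x1 ≗ x ⇒ x ⊕ u ≗ n ⇒ ⊢ u ⊕ x1 ≗ n ⊕ con 0) refl (*-identityʳ x) x+u≡n))
      (forward true (suc a))
      (linear (u ∷ k ∷ a * k ∷ p ∷ n ∷ r ∷ x ∷ [])
        (λ u k ak p n r x → x ⊕ u ≗ n ⇒ r ⊕ x ≗ k ⇒ p ≗ ak ⊕ r ⇒ ⊢ u ⊕ (k ⊕ ak) ≗ p ⊕ (n ⊕ con 0)) refl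
        x+u≡n r+x≡k p≡)
      (linear (x ∷ a ∷ r ∷ k ∷ W ∷ [])
        (λ x a r k W → r ⊕ x ≗ k ⇒ a ⊕ con 1 ⊕ k ≼ W ⊕ r ⇒ ⊢ x ⊕ (con 1 ⊕ a) ≼ W) refl r+x≡k a+1+k≤W+r)
    -- Both legs run backwards, with complements u = n - s and v = n - d k.
    go (inj₂ (inj₁ d+s≤W))
      with m≤n⇒∃[o]m+o≡n (≤-trans (m%n≤n (n ∸ p) k) k≤n)
         | m≤n⇒∃[o]m+o≡n (≤-trans (m≤m+n (d * k) s) (≤-trans (≤-reflexive (sym n∸p≡)) (m∸n≤m n p)))
    ... | u , s+u≡n | v , dk+v≡n = via 1
      (backward false s u 1
        (linear (u ∷ s * 1 ∷ s ∷ n ∷ [])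
          (λ u s1 s n → s1 ≗ s ⇒ s ⊕ u ≗ n ⇒ ⊢ u ⊕ s1 ≗ n ⊕ con 0) refl (*-identityʳ s) s+u≡n))
      (backward true d v 1 (trans (+-comm v (d * k)) (trans dk+v≡n (sym (*-identityˡ n)))))
      (linear (u ∷ v ∷ d * k ∷ a * k ∷ r ∷ s ∷ p ∷ n ∷ [])
        (λ u v dk ak r s p n → s ⊕ u ≗ n ⇒ dk ⊕ v ≗ n ⇒ p ≗ ak ⊕ r ⇒ ak ⊕ r ⊕ (dk ⊕ s) ≗ n ⇒
          ⊢ u ⊕ v ≗ p ⊕ (n ⊕ con 0)) refl s+u≡n dk+v≡n p≡ whole)
      (≤-trans (≤-reflexive (+-comm s d)) d+s≤W)
    -- Backward overshoot by d + 1 inner steps. As (d + 1) k may exceed n, its complement is taken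
    -- in 2 n.
    go (inj₂ (inj₂ d+1+k≤W+s))
      with m≤n⇒∃[o]m+o≡n (m%n≤n (n ∸ p) k)
         | m≤n⇒∃[o]m+o≡n (+-mono-≤ k≤n (≤-trans (m≤m+n (d * k) s) (≤-trans (≤-reflexive (sym n∸p≡)) (m∸n≤m n p))))
    ... | x , s+x≡k | v , k+dk+v≡2n = via 1
      (forward false x)
      (backward true (suc d) v 2
        (linear (v ∷ k ∷ d * k ∷ n ∷ [])
          (λ v k dk n → k ⊕ dk ⊕ v ≗ n ⊕ n ⇒ ⊢ v ⊕ (k ⊕ dk) ≗ n ⊕ (n ⊕ con 0)) refl k+dk+v≡2n))
      (linear (x * 1 ∷ x ∷ v ∷ k ∷ d * k ∷ a * k ∷ r ∷ s ∷ p ∷ n ∷ [])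
        (λ x1 x v k dk ak r s p n → x1 ≗ x ⇒ s ⊕ x ≗ k ⇒ k ⊕ dk ⊕ v ≗ n ⊕ n ⇒ p ≗ ak ⊕ r ⇒
          ak ⊕ r ⊕ (dk ⊕ s) ≗ n ⇒ ⊢ x1 ⊕ v ≗ p ⊕ (n ⊕ con 0)) refl (*-identityʳ x) s+x≡k k+dk+v≡2n p≡ whole)
      (linear (x ∷ d ∷ s ∷ k ∷ W ∷ [])
        (λ x d s k W → s ⊕ x ≗ k ⇒ d ⊕ con 1 ⊕ k ≼ W ⊕ s ⇒ ⊢ x ⊕ (con 1 ⊕ d) ≼ W) refl s+x≡k d+1+k≤W+s)

-- The distance 2 + W is attained between `u_0` and `u_p` with p = a k + r: `connected` bounds it
-- from above, `walk-length` from below.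
diameter : ∀ {n k W a r b s} .{{_ : NonZero n}} .{{_ : NonZero k}} → k ≤ n →
           Short n k W → n ≡ a * k + r + (b * k + s) → Long n k W a r → Long n k W b s → Diam n k (2 + W)
diameter {n} {k} {W} {a} {r} {b} {s} k≤n short split out back =
  (λ x y → let d , d≤ , w = connected k≤n short x y
               e , e≤d , dist = shortest w
           in e , ≤-trans e≤d d≤ , dist) ,
  antipode
  where
  0<n : 0 < n
  0<n = >-nonZero⁻¹ n
  p<n : a * k + r < n
  -- The field `outer` of the far side makes b k + s positive.
  p<n = linear (a * k ∷ r ∷ b * k ∷ s ∷ n ∷ W ∷ [])
    (λ ak r bk s n W → n ≗ ak ⊕ r ⊕ (bk ⊕ s) ⇒ con 2 ⊕ W ≼ bk ⊕ s ⇒ ⊢ con 1 ⊕ (ak ⊕ r) ≼ n) refl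
    split (Long.outer back)
  antipode : ∃[ x ] ∃[ y ] Dist n k x y (2 + W)
  antipode with connected k≤n short (false , fromℕ< 0<n) (false , fromℕ< p<n)
  ... | d , d≤ , w = _ , _ , subst (Walk n k _ _) (≤-antisym d≤ (far w)) w , λ e e< v → <⇒≱ e< (far v)
    where
    far : ∀ {e} → Walk n k (false , fromℕ< 0<n) (false , fromℕ< p<n) e → 2 + W ≤ e
    far = walk-length split out back (Fin.toℕ-fromℕ< 0<n) (Fin.toℕ-fromℕ< p<n)

-- The diameter in terms of n = q k + e

halves : ∀ m → ∃[ f ] ∃[ c ] f + c ≡ m × f ≤ c × c ≤ suc f
halves zero    = 0 , 0 , refl , z≤n , z≤n
halves (suc m) with halves m
... | f , c , f+c≡m , f≤c , c≤1+f =
  c , suc f , trans (+-suc c f) (cong suc (trans (+-comm c f) f+c≡m)) , c≤1+f , s≤s f≤c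

quotient-unique : ∀ {k x y f g} → f < k → g < k → x * k + f ≡ y * k + g → x ≤ y
quotient-unique {k} {x} {y} {f} {g} f<k g<k eq = ≮⇒≥ λ y<x →
  n≮n 0 (linear (k ∷ x * k ∷ y * k ∷ f ∷ g ∷ [])
    (λ k xk yk f g → con 1 ⊕ f ≼ k ⇒ con 1 ⊕ g ≼ k ⇒ xk ⊕ f ≗ yk ⊕ g ⇒ k ⊕ yk ≼ xk ⇒ ⊢ con 1 ≼ con 0) refl
    f<k g<k eq (*-monoˡ-≤ k y<x))

division-unique : ∀ {k x y f g} → f < k → g < k → x * k + f ≡ y * k + g → x ≡ y × f ≡ g
division-unique {k} {x} {y} {f} {g} f<k g<k eq
  with ≤-antisym (quotient-unique {k} {x} f<k g<k eq) (quotient-unique {k} {y} g<k f<k (sym eq))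
... | refl = refl , +-cancelˡ-≡ (x * k) f g eq

module _ {n k q e : ℕ} (n≡ : n ≡ q * k + e) (e<k : e < k) where

  -- As r + s < 2 k, adding the remainders carries at most once; uniqueness of division does the
  -- rest.
  carry : ∀ a r b s → r < k → s < k → a * k + r + (b * k + s) ≡ n →
          (r + s ≡ e × a + b ≡ q) ⊎ (r + s ≡ k + e × a + b + 1 ≡ q)
  carry a r b s r<k s<k whole with <-≤-connex (r + s) k
  ... | inj₁ r+s<k =
    let q≡ , e≡ = division-unique {k} {a + b} r+s<k e<k
          (linear (a * k ∷ r ∷ b * k ∷ s ∷ (a + b) * k ∷ n ∷ q * k ∷ e ∷ [])
            (λ ak r bk s abk n qk e → ak ⊕ r ⊕ (bk ⊕ s) ≗ n ⇒ n ≗ qk ⊕ e ⇒ abk ≗ ak ⊕ bk ⇒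
              ⊢ abk ⊕ (r ⊕ s) ≗ qk ⊕ e) refl whole n≡ (*-distribʳ-+ k a b))
    in inj₁ (e≡ , q≡)
  ... | inj₂ k≤r+s with m≤n⇒∃[o]m+o≡n k≤r+s
  ... | f , k+f≡r+s =
    let q≡ , e≡ = division-unique {k} {a + b + 1}
          (linear (k ∷ f ∷ r ∷ s ∷ [])
            (λ k f r s → k ⊕ f ≗ r ⊕ s ⇒ con 1 ⊕ r ≼ k ⇒ con 1 ⊕ s ≼ k ⇒ ⊢ con 1 ⊕ f ≼ k) refl k+f≡r+s r<k s<k)
          e<k
          (linear (a * k ∷ r ∷ b * k ∷ s ∷ (a + b + 1) * k ∷ (a + b) * k ∷ n ∷ q * k ∷ e ∷ k ∷ f ∷ [])
            (λ ak r bk s ab1k abk n qk e k f → ak ⊕ r ⊕ (bk ⊕ s) ≗ n ⇒ n ≗ qk ⊕ e ⇒ abk ≗ ak ⊕ bk ⇒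
              ab1k ≗ abk ⊕ (k ⊕ con 0) ⇒ k ⊕ f ≗ r ⊕ s ⇒
              ⊢ ab1k ⊕ f ≗ qk ⊕ e) refl whole n≡ (*-distribʳ-+ k a b) (*-distribʳ-+ k (a + b) 1) k+f≡r+s)
    in inj₂ (trans (sym k+f≡r+s) (cong (k +_) e≡) , q≡)

  -- Suppose all four costs exceed W. Without a carry, a + r and b + s sum to q + e ≤ 2 W + 1, which
  -- is absurd; the case with a carry is left to the caller.
  short : ∀ {W} → q + e ≤ 2 * W + 1 →
          (∀ a r b s → r + s ≡ k + e → a + b + 1 ≡ q →
             W < a + r → W + r < a + 1 + k → W < b + s → W + s < b + 1 + k → ⊥) →
          Short n k W
  short {W} q+e≤ carried a r b s r<k s<k whole
    with ≤-<-connex (a + r) W | ≤-<-connex (a + 1 + k) (W + r)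
       | ≤-<-connex (b + s) W | ≤-<-connex (b + 1 + k) (W + s)
  ... | inj₁ p | _ | _ | _ = inj₁ (inj₁ p)
  ... | _ | inj₁ p | _ | _ = inj₁ (inj₂ p)
  ... | _ | _ | inj₁ p | _ = inj₂ (inj₁ p)
  ... | _ | _ | _ | inj₁ p = inj₂ (inj₂ p)
  ... | inj₂ p₁ | inj₂ p₂ | inj₂ p₃ | inj₂ p₄ with carry a r b s r<k s<k whole
  ... | inj₂ (r+s≡ , a+b≡) = ⊥-elim (carried a r b s r+s≡ a+b≡ p₁ p₂ p₃ p₄)
  ... | inj₁ (r+s≡ , a+b≡) = ⊥-elim (n≮n 0
    (linear (a ∷ r ∷ b ∷ s ∷ q ∷ e ∷ W ∷ [])
      (λ a r b s q e W → q ⊕ e ≼ 2 ⊛ W ⊕ con 1 ⇒ r ⊕ s ≗ e ⇒ a ⊕ b ≗ q ⇒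
        con 1 ⊕ W ≼ a ⊕ r ⇒ con 1 ⊕ W ≼ b ⊕ s ⇒ ⊢ con 1 ≼ con 0) refl q+e≤ r+s≡ a+b≡ p₁ p₃))

  -- With a carry, the overshooting costs sum to q + 1 + k - e ≤ 2 W + 1, so one of them is at most
  -- W.
  short-generic : ∀ {W} → q + e ≤ 2 * W + 1 → q + k ≤ 2 * W + e → Short n k W
  short-generic {W} q+e≤ q+k≤ = short q+e≤ λ a r b s r+s≡ a+b≡ _ p₂ _ p₄ → n≮n 0
    (linear (a ∷ r ∷ b ∷ s ∷ q ∷ e ∷ k ∷ W ∷ [])
      (λ a r b s q e k W → q ⊕ k ≼ 2 ⊛ W ⊕ e ⇒ r ⊕ s ≗ k ⊕ e ⇒ a ⊕ b ⊕ con 1 ≗ q ⇒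
        con 1 ⊕ (W ⊕ r) ≼ a ⊕ con 1 ⊕ k ⇒ con 1 ⊕ (W ⊕ s) ≼ b ⊕ con 1 ⊕ k ⇒ ⊢ con 1 ≼ con 0) refl
      q+k≤ r+s≡ a+b≡ p₂ p₄)

  -- For e = 0 and a carry, a + r and b + s sum to q + k - 1 ≤ 2 W + 1, which beats the overshooting
  -- costs.
  short-exact : ∀ {W} → q + e ≤ 2 * W + 1 → e ≡ 0 → q + k ≤ 2 * W + 2 → Short n k W
  short-exact {W} q+e≤ e≡0 q+k≤ = short q+e≤ λ a r b s r+s≡ a+b≡ p₁ _ p₃ _ → n≮n 0
    (linear (a ∷ r ∷ b ∷ s ∷ q ∷ e ∷ k ∷ W ∷ [])
      (λ a r b s q e k W → e ≗ con 0 ⇒ q ⊕ k ≼ 2 ⊛ W ⊕ con 2 ⇒ r ⊕ s ≗ k ⊕ e ⇒ a ⊕ b ⊕ con 1 ≗ q ⇒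
        con 1 ⊕ W ≼ a ⊕ r ⇒ con 1 ⊕ W ≼ b ⊕ s ⇒ ⊢ con 1 ≼ con 0) refl
      e≡0 q+k≤ r+s≡ a+b≡ p₁ p₃)

  -- If all four costs exceeded W they would all equal W + 1, forcing r = s and hence k + 1 = 2 r.
  short-even : ∀ {W} → q + e ≤ 2 * W + 1 → e ≡ 1 → Even k → q + k ≤ 2 * W + 2 → Short n k W
  short-even {W} q+e≤ refl (t , refl) q+k≤ = short q+e≤ λ a r b s r+s≡ a+b≡ p₁ p₂ p₃ p₄ →
    let r≡s = linear (a ∷ r ∷ b ∷ s ∷ q ∷ t ∷ W ∷ [])
                (λ a r b s q t W → q ⊕ 2 ⊛ t ≼ 2 ⊛ W ⊕ con 2 ⇒ r ⊕ s ≗ 2 ⊛ t ⊕ con 1 ⇒ a ⊕ b ⊕ con 1 ≗ q ⇒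
                  con 1 ⊕ W ≼ a ⊕ r ⇒ con 1 ⊕ (W ⊕ r) ≼ a ⊕ con 1 ⊕ 2 ⊛ t ⇒
                  con 1 ⊕ W ≼ b ⊕ s ⇒ con 1 ⊕ (W ⊕ s) ≼ b ⊕ con 1 ⊕ 2 ⊛ t ⇒ ⊢ r ≗ s) refl
                q+k≤ r+s≡ a+b≡ p₁ p₂ p₃ p₄
    in even≢odd r t (trans (cong (λ s → r + s) (trans (+-identityʳ r) r≡s)) (trans r+s≡ (+-comm (2 * t) 1)))

  module _ .{{_ : NonZero n}} .{{_ : NonZero k}} (3≤k : 3 ≤ k) (k≤2q : k ≤ 2 * q) (2≤q : 2 ≤ q) where

    k≤n : k ≤ n
    k≤n = linear (k ∷ q * k ∷ e ∷ n ∷ []) (λ k qk e n → k ⊕ (k ⊕ con 0) ≼ qk ⇒ n ≗ qk ⊕ e ⇒ ⊢ k ≼ n) refl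
            (*-monoˡ-≤ k 2≤q) n≡

    -- From W ≤ q + a + 1 follows W k ≤ q k + a k + k, and r ≥ 1 makes `wrap` strict. For `outer`, a
    -- k ≥ 3 a ≥ a + 2.
    long : ∀ {W a r} → 1 ≤ a → 1 ≤ r → r ≤ k → W ≤ a + r → W + r ≤ a + 1 + k → W ≤ q + a + 1 → Long n k W a r
    long {W} {a} {r} 1≤a 1≤r r≤k low high W≤ = record
      { r≤k   = r≤k
      ; low   = low
      ; high  = high
      ; wrap  = linear (W * k ∷ (q + a + 1) * k ∷ (q + a) * k ∷ q * k ∷ a * k ∷ k ∷ e ∷ r ∷ n ∷ [])
          (λ Wk qa1k qak qk ak k e r n → Wk ≼ qa1k ⇒ qa1k ≗ qak ⊕ (k ⊕ con 0) ⇒ qak ≗ qk ⊕ ak ⇒ n ≗ qk ⊕ e ⇒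
            con 1 ≼ r ⇒ ⊢ con 1 ⊕ Wk ≼ n ⊕ (ak ⊕ r) ⊕ k) refl
          (*-monoˡ-≤ k W≤) (*-distribʳ-+ k (q + a) 1) (*-distribʳ-+ k q a) n≡ 1≤r
      ; outer = linear (W ∷ a * 3 ∷ a * k ∷ a ∷ r ∷ [])
          (λ W a3 ak a r → a3 ≼ ak ⇒ a3 ≗ 3 ⊛ a ⇒ con 1 ≼ a ⇒ W ≼ a ⊕ r ⇒ ⊢ con 2 ⊕ W ≼ ak ⊕ r) refl
          (*-monoʳ-≤ a 3≤k) (*-comm a 3) 1≤a low
      }

    -- The hypotheses of `long` for both sides, bundled so that one call of `linear` proves them.
    -- The bounds on q + a + 1 and q + b + 1 are where k ≤ 2 q enters.
    Bounds : (W a r b s : ℕ) → Set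
    Bounds W a r b s =
      1 ≤ a × 1 ≤ r × r ≤ k × W ≤ a + r × W + r ≤ a + 1 + k × W ≤ q + a + 1 ×
      1 ≤ b × 1 ≤ s × s ≤ k × W ≤ b + s × W + s ≤ b + 1 + k × W ≤ q + b + 1

    diameter-bounds : ∀ {W a r b s} → Short n k W → n ≡ a * k + r + (b * k + s) → Bounds W a r b s →
                      Diam n k (2 + W)
    diameter-bounds shorts split (p₁ , p₂ , p₃ , p₄ , p₅ , p₆ , q₁ , q₂ , q₃ , q₄ , q₅ , q₆) =
      diameter k≤n shorts split (long p₁ p₂ p₃ p₄ p₅ p₆) (long q₁ q₂ q₃ q₄ q₅ q₆)

    uncarried : ∀ a b r s → a + b ≡ q → r + s ≡ e → n ≡ a * k + r + (b * k + s)
    uncarried a b r s refl refl = trans n≡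
      (linear ((a + b) * k ∷ a * k ∷ b * k ∷ r ∷ s ∷ [])
        (λ abk ak bk r s → abk ≗ ak ⊕ bk ⇒ ⊢ abk ⊕ (r ⊕ s) ≗ ak ⊕ r ⊕ (bk ⊕ s)) refl (*-distribʳ-+ k a b))

    carried : ∀ a b r s → suc (a + b) ≡ q → r + s ≡ k + e → n ≡ a * k + r + (b * k + s)
    carried a b r s refl r+s≡ = trans n≡
      (linear ((a + b) * k ∷ a * k ∷ b * k ∷ r ∷ s ∷ k ∷ e ∷ [])
        (λ abk ak bk r s k e → abk ≗ ak ⊕ bk ⇒ r ⊕ s ≗ k ⊕ e ⇒ ⊢ k ⊕ abk ⊕ e ≗ ak ⊕ r ⊕ (bk ⊕ s)) refl
        (*-distribʳ-+ k a b) r+s≡)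

    diameter-large-remainder : ∀ {W} → 2 * W ≤ q + e → q + e ≤ 2 * W + 1 → q + k ≤ 2 * W + e → Diam n k (2 + W)
    diameter-large-remainder {W} 2W≤ ≤2W+1 q+k≤ with halves q | halves e
    -- The smaller half of q meets the larger half of e, so a + r and b + s differ by at most one.
    ... | a , b , a+b≡q , a≤b , b≤1+a | s , r , s+r≡e , s≤r , r≤1+s =
      diameter-bounds (short-generic ≤2W+1 q+k≤) (uncarried a b r s a+b≡q (trans (+-comm r s) s+r≡e))
      (linear (a ∷ b ∷ r ∷ s ∷ q ∷ e ∷ k ∷ W ∷ [])
        (λ a b r s q e k W → con 3 ≼ k ⇒ con 1 ⊕ e ≼ k ⇒ k ≼ 2 ⊛ q ⇒ con 2 ≼ q ⇒
           2 ⊛ W ≼ q ⊕ e ⇒ q ⊕ k ≼ 2 ⊛ W ⊕ e ⇒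
           a ⊕ b ≗ q ⇒ a ≼ b ⇒ b ≼ con 1 ⊕ a ⇒ s ⊕ r ≗ e ⇒ s ≼ r ⇒ r ≼ con 1 ⊕ s ⇒
           con 1 ≼ a & con 1 ≼ r & r ≼ k & W ≼ a ⊕ r & W ⊕ r ≼ a ⊕ con 1 ⊕ k & W ≼ q ⊕ a ⊕ con 1 &
           con 1 ≼ b & con 1 ≼ s & s ≼ k & W ≼ b ⊕ s & W ⊕ s ≼ b ⊕ con 1 ⊕ k & ⊢ W ≼ q ⊕ b ⊕ con 1) refl
        3≤k e<k k≤2q 2≤q 2W≤ q+k≤ a+b≡q a≤b b≤1+a s+r≡e s≤r r≤1+s)

    -- `Short` stays a hypothesis, since e = 1 with k even calls for `short-even` instead of
    -- `short-generic`.
    diameter-small-remainder : ∀ {W} → 3 ≤ q → 1 ≤ e → 2 * W + e ≤ q + k + 1 → 2 * W + 2 ≤ q + k + e →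
                     Short n k W → Diam n k (2 + W)
    diameter-small-remainder {W} 3≤q 1≤e 2W+e≤ 2W+2≤ shorts with m≤n⇒∃[o]m+o≡n (≤-trans (s≤s z≤n) 3≤q)
    ... | p , 1+p≡q with halves p | halves (k + e)
    -- Smaller halves meet, which balances a - r against b - s and so the overshooting costs. Then a
    -- + r and b + s differ by at most two, for which 2 W + 2 ≤ q + k + e leaves room.
    ... | a , b , a+b≡p , a≤b , b≤1+a | r , s , r+s≡k+e , r≤s , s≤1+r =
      diameter-bounds shorts (carried a b r s (trans (cong suc a+b≡p) 1+p≡q) r+s≡k+e)
      (linear (a ∷ b ∷ r ∷ s ∷ p ∷ q ∷ e ∷ k ∷ W ∷ [])
        (λ a b r s p q e k W → con 3 ≼ k ⇒ con 1 ⊕ e ≼ k ⇒ k ≼ 2 ⊛ q ⇒ con 3 ≼ q ⇒ con 1 ≼ e ⇒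
           2 ⊛ W ⊕ e ≼ q ⊕ k ⊕ con 1 ⇒ 2 ⊛ W ⊕ con 2 ≼ q ⊕ k ⊕ e ⇒ con 1 ⊕ p ≗ q ⇒
           a ⊕ b ≗ p ⇒ a ≼ b ⇒ b ≼ con 1 ⊕ a ⇒ r ⊕ s ≗ k ⊕ e ⇒ r ≼ s ⇒ s ≼ con 1 ⊕ r ⇒
           con 1 ≼ a & con 1 ≼ r & r ≼ k & W ≼ a ⊕ r & W ⊕ r ≼ a ⊕ con 1 ⊕ k & W ≼ q ⊕ a ⊕ con 1 &
           con 1 ≼ b & con 1 ≼ s & s ≼ k & W ≼ b ⊕ s & W ⊕ s ≼ b ⊕ con 1 ⊕ k & ⊢ W ≼ q ⊕ b ⊕ con 1) refl
        3≤k e<k k≤2q 3≤q 1≤e 2W+e≤ 2W+2≤ 1+p≡q a+b≡p a≤b b≤1+a r+s≡k+e r≤s s≤1+r)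

    diameter-no-remainder : ∀ {W} → 3 ≤ q → e ≡ 0 → 2 * W + 1 ≤ q + k → q + k ≤ 2 * W + 2 → Diam n k (2 + W)
    diameter-no-remainder {W} 3≤q e≡0 2W+1≤ q+k≤ with m≤n⇒∃[o]m+o≡n (≤-trans (s≤s z≤n) 3≤q)
    ... | p , 1+p≡q with halves p | halves (k + e)
    -- For e = 0 the decisive costs are a + r and b + s, so the halves are crossed again.
    ... | a , b , a+b≡p , a≤b , b≤1+a | s , r , s+r≡k+e , s≤r , r≤1+s =
      diameter-bounds
      (short-exact
        (linear (q ∷ e ∷ k ∷ W ∷ [])
          (λ q e k W → con 3 ≼ k ⇒ e ≗ con 0 ⇒ q ⊕ k ≼ 2 ⊛ W ⊕ con 2 ⇒ ⊢ q ⊕ e ≼ 2 ⊛ W ⊕ con 1) refl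
          3≤k e≡0 q+k≤)
        e≡0 q+k≤)
      (carried a b r s (trans (cong suc a+b≡p) 1+p≡q) (trans (+-comm r s) s+r≡k+e))
      (linear (a ∷ b ∷ r ∷ s ∷ p ∷ q ∷ e ∷ k ∷ W ∷ [])
        (λ a b r s p q e k W → con 3 ≼ k ⇒ k ≼ 2 ⊛ q ⇒ con 3 ≼ q ⇒ e ≗ con 0 ⇒
           2 ⊛ W ⊕ con 1 ≼ q ⊕ k ⇒ con 1 ⊕ p ≗ q ⇒
           a ⊕ b ≗ p ⇒ a ≼ b ⇒ b ≼ con 1 ⊕ a ⇒ s ⊕ r ≗ k ⊕ e ⇒ s ≼ r ⇒ r ≼ con 1 ⊕ s ⇒
           con 1 ≼ a & con 1 ≼ r & r ≼ k & W ≼ a ⊕ r & W ⊕ r ≼ a ⊕ con 1 ⊕ k & W ≼ q ⊕ a ⊕ con 1 &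
           con 1 ≼ b & con 1 ≼ s & s ≼ k & W ≼ b ⊕ s & W ⊕ s ≼ b ⊕ con 1 ⊕ k & ⊢ W ≼ q ⊕ b ⊕ con 1) refl
        3≤k k≤2q 3≤q e≡0 2W+1≤ 1+p≡q a+b≡p a≤b b≤1+a s+r≡k+e s≤r r≤1+s)

    -- Both q - 1 and k + 1 are even, so exact halves make all four costs equal to W = (q + k) / 2.
    -- This violates 2 W + 2 ≤ q + k + e, hence the separate treatment.
    diameter-remainder-one-odd : ∀ {W} m t → 3 ≤ q → e ≡ 1 → q ≡ 1 + 2 * m → k ≡ 1 + 2 * t → W ≡ m + t + 1 →
                       Diam n k (2 + W)
    diameter-remainder-one-odd {W} m t 3≤q e≡1 q≡ k≡ W≡ =
      diameter-bounds
      (linear (q ∷ e ∷ k ∷ W ∷ m ∷ t ∷ [])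
        (λ q e k W m t → con 3 ≼ k ⇒ e ≗ con 1 ⇒ q ≗ con 1 ⊕ 2 ⊛ m ⇒ k ≗ con 1 ⊕ 2 ⊛ t ⇒ W ≗ m ⊕ t ⊕ con 1 ⇒
           q ⊕ e ≼ 2 ⊛ W ⊕ con 1 & ⊢ q ⊕ k ≼ 2 ⊛ W ⊕ e) refl 3≤k e≡1 q≡ k≡ W≡
        |> λ (p , p′) → short-generic p p′)
      (carried m m (suc t) (suc t)
        (trans (cong (λ x → suc (m + x)) (sym (+-identityʳ m))) (sym q≡))
        (linear (k ∷ e ∷ t ∷ [])
          (λ k e t → e ≗ con 1 ⇒ k ≗ con 1 ⊕ 2 ⊛ t ⇒ ⊢ (con 1 ⊕ t) ⊕ (con 1 ⊕ t) ≗ k ⊕ e) refl e≡1 k≡))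
      (linear (m ∷ t ∷ q ∷ k ∷ W ∷ [])
        (λ a t q k W → let r = con 1 ⊕ t; b = a; s = r in
           con 3 ≼ k ⇒ k ≼ 2 ⊛ q ⇒ con 3 ≼ q ⇒
           q ≗ con 1 ⊕ 2 ⊛ a ⇒ k ≗ con 1 ⊕ 2 ⊛ t ⇒ W ≗ a ⊕ t ⊕ con 1 ⇒
           con 1 ≼ a & con 1 ≼ r & r ≼ k & W ≼ a ⊕ r & W ⊕ r ≼ a ⊕ con 1 ⊕ k & W ≼ q ⊕ a ⊕ con 1 &
           con 1 ≼ b & con 1 ≼ s & s ≼ k & W ≼ b ⊕ s & W ⊕ s ≼ b ⊕ con 1 ⊕ k & ⊢ W ≼ q ⊕ b ⊕ con 1) refl
        3≤k k≤2q 3≤q q≡ k≡ W≡)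

-- Halving k and dividing n by k

2*[m/2]≡m : ∀ {m} → Even m → 2 * (m / 2) ≡ m
2*[m/2]≡m (t , refl) = cong (2 *_) (trans (cong (_/ 2) (*-comm 2 t)) (m*n/n≡m t 2))

module _ {k : ℕ} where

  halve-even : Even k → 2 * (k / 2) ≡ k
  halve-even = 2*[m/2]≡m

  halve-even-∸2 : Even k → 2 ≤ k → 2 + 2 * ((k ∸ 2) / 2) ≡ k
  halve-even-∸2 (t , refl) 2≤k =
    trans (cong (2 +_) (2*[m/2]≡m (t ∸ 1 , sym (*-distribˡ-∸ 2 t 1)))) (m+[n∸m]≡n 2≤k)

  halve-odd-∸1 : Odd k → 1 + 2 * ((k ∸ 1) / 2) ≡ k
  halve-odd-∸1 (t , refl) = cong suc (2*[m/2]≡m (t , refl))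

  halve-odd-+1 : Odd k → 2 * ((k + 1) / 2) ≡ k + 1
  halve-odd-+1 (t , refl) = 2*[m/2]≡m (suc t ,
    linear (t ∷ []) (λ t → ⊢ con 1 ⊕ 2 ⊛ t ⊕ con 1 ≗ 2 ⊛ (con 1 ⊕ t)) refl)

-- A positive truncated difference is a true one; this recovers k + e = 2 j or 2 j + 1 from the
-- conditions on e.
n+[m∸n]≡m : ∀ {m n} → 0 < m ∸ n → n + (m ∸ n) ≡ m
n+[m∸n]≡m {m} {n} 0<m∸n = m+[n∸m]≡n {n} {m} (<⇒≤ (m∸n≢0⇒n<m (>⇒≢ 0<m∸n)))

module _ {n k : ℕ} (m j : ℕ) where

  private
    2m*k : 2 * m * k ≡ 2 * (m * k)
    2m*k = *-assoc 2 m k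

  -- Doubling m k + j gives quotient 2 m while the doubled remainder stays below k, and 2 m + 1
  -- otherwise. Up to boundary values of j, this separates the low cases from the high ones.
  even-quotient₀ : n ≡ 2 * (m * k + j) → n ≡ 2 * m * k + 2 * j
  even-quotient₀ = linear (n ∷ m * k ∷ j ∷ 2 * m * k ∷ [])
    (λ n mk j 2mk → 2mk ≗ 2 ⊛ mk ⇒ n ≗ 2 ⊛ (mk ⊕ j) ⇒ ⊢ n ≗ 2mk ⊕ 2 ⊛ j) refl 2m*k

  even-quotient₁ : n ≡ 2 * (m * k + j) + 1 → n ≡ 2 * m * k + (2 * j + 1)
  even-quotient₁ = linear (n ∷ m * k ∷ j ∷ 2 * m * k ∷ [])
    (λ n mk j 2mk → 2mk ≗ 2 ⊛ mk ⇒ n ≗ 2 ⊛ (mk ⊕ j) ⊕ con 1 ⇒ ⊢ n ≗ 2mk ⊕ (2 ⊛ j ⊕ con 1)) refl 2m*k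

  odd-quotient₀ : ∀ {e} → n ≡ 2 * (m * k + j) → k + e ≡ 2 * j → n ≡ (1 + 2 * m) * k + e
  odd-quotient₀ {e} = linear (n ∷ m * k ∷ j ∷ 2 * m * k ∷ k ∷ e ∷ [])
    (λ n mk j 2mk k e → 2mk ≗ 2 ⊛ mk ⇒ n ≗ 2 ⊛ (mk ⊕ j) ⇒ k ⊕ e ≗ 2 ⊛ j ⇒ ⊢ n ≗ k ⊕ 2mk ⊕ e) refl 2m*k

  odd-quotient₁ : ∀ {e} → n ≡ 2 * (m * k + j) + 1 → k + e ≡ 2 * j + 1 → n ≡ (1 + 2 * m) * k + e
  odd-quotient₁ {e} = linear (n ∷ m * k ∷ j ∷ 2 * m * k ∷ k ∷ e ∷ [])
    (λ n mk j 2mk k e → 2mk ≗ 2 ⊛ mk ⇒ n ≗ 2 ⊛ (mk ⊕ j) ⊕ con 1 ⇒ k ⊕ e ≗ 2 ⊛ j ⊕ con 1 ⇒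
      ⊢ n ≗ k ⊕ 2mk ⊕ e) refl 2m*k

-- The cases of the theorem

module GeneralizedPetersen
         (n k : ℕ) (3≤k : 3 ≤ k) (2k<n : 2 * k < n)
         (k≡3⇒8≤n : k ≡ 3 → 8 ≤ n) (k≡4⇒10≤n : k ≡ 4 → 10 ≤ n)
         (odd-bound : Odd k → 5 ≤ k → k * (k + 1) ≤ 2 * n)
         (even-bound : Even k → 6 ≤ k → k * k ≤ 2 * n) where

  instance
    k≢0 : NonZero k
    k≢0 = >-nonZero (≤-trans (s≤s z≤n) 3≤k)

    n≢0 : NonZero n
    n≢0 = >-nonZero (≤-trans (s≤s z≤n) 2k<n)

  module _ {q e : ℕ} (n≡ : n ≡ q * k + e) (e<k : e < k) where

    2≤q : 2 ≤ q
    2≤q = ≮⇒≥ λ q<2 → n≮n 0 (linear (n ∷ k ∷ q * k ∷ e ∷ [])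
      (λ n k qk e → con 1 ⊕ 2 ⊛ k ≼ n ⇒ n ≗ qk ⊕ e ⇒ con 1 ⊕ e ≼ k ⇒ qk ≼ 1 ⊛ k ⇒ ⊢ con 1 ≼ con 0) refl
      2k<n n≡ e<k (*-monoˡ-≤ k (s≤s⁻¹ q<2)))

    2n<[2q+2]k : 2 * n < (2 * q + 2) * k
    2n<[2q+2]k = linear (n ∷ (2 * q + 2) * k ∷ 2 * q * k ∷ q * k ∷ k ∷ e ∷ [])
      (λ n rhs 2qk qk k e → rhs ≗ 2qk ⊕ 2 ⊛ k ⇒ 2qk ≗ 2 ⊛ qk ⇒ n ≗ qk ⊕ e ⇒ con 1 ⊕ e ≼ k ⇒
        ⊢ con 1 ⊕ 2 ⊛ n ≼ rhs) refl
      (*-distribʳ-+ k (2 * q) 2) (*-assoc 2 q k) n≡ e<k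

    -- The quadratic bounds on n and 2 n < (2 q + 2) k give k + 1 < 2 q + 2 for odd k and k < 2 q +
    -- 2 for even k, where parity gains the last unit. For k ≤ 4 the claim follows from q ≥ 2.
    k≤2q : Odd k ⊎ Even k → k ≤ 2 * q
    k≤2q parity with ≤-<-connex k 4
    ... | inj₁ k≤4 = ≤-trans k≤4 (*-monoʳ-≤ 2 2≤q)
    k≤2q (inj₁ odd) | inj₂ 5≤k =
      linear (k ∷ q ∷ []) (λ k q → con 1 ⊕ (k ⊕ con 1) ≼ 2 ⊛ q ⊕ con 2 ⇒ ⊢ k ≼ 2 ⊛ q) refl
        (*-cancelʳ-< k (k + 1) (2 * q + 2)
          (≤-<-trans (≤-trans (≤-reflexive (*-comm (k + 1) k)) (odd-bound odd 5≤k)) 2n<[2q+2]k))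
    k≤2q (inj₂ even@(t , k≡2t)) | inj₂ 5≤k = ≤-trans (≤-reflexive k≡2t) (*-monoʳ-≤ 2
      (linear (k ∷ q ∷ t ∷ [])
        (λ k q t → con 1 ⊕ k ≼ 2 ⊛ q ⊕ con 2 ⇒ k ≗ 2 ⊛ t ⇒ ⊢ t ≼ q) refl
        (*-cancelʳ-< k k (2 * q + 2) (≤-<-trans (even-bound even 6≤k) 2n<[2q+2]k)) k≡2t))
      where
      6≤k : 6 ≤ k
      6≤k = ≤-trans
        (*-monoʳ-≤ 2 (linear (k ∷ t ∷ []) (λ k t → con 5 ≼ k ⇒ k ≗ 2 ⊛ t ⇒ ⊢ con 3 ≼ t) refl 5≤k k≡2t))
        (≤-reflexive (sym k≡2t))

    -- If q = 2 then k ≤ 4, and e ≤ 1 forces n ≤ 7 for k = 3 and n ≤ 9 for k = 4, against the two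
    -- special bounds on n.
    3≤q : Odd k ⊎ Even k → Odd q ⊎ (k ≤ 4 → e ≤ 1) → 3 ≤ q
    3≤q _ (inj₁ (m , refl)) = s≤s (*-monoʳ-≤ 2
      (linear (m ∷ []) (λ m → con 2 ≼ con 1 ⊕ 2 ⊛ m ⇒ ⊢ con 1 ≼ m) refl 2≤q))
    3≤q parity (inj₂ small) = ≮⇒≥ λ q<3 → excluded (≤-antisym (s≤s⁻¹ q<3) 2≤q)
      where
      excluded : q ≢ 2
      excluded refl with m≤n⇒m<n∨m≡n (k≤2q parity)
      ... | inj₂ refl = <⇒≱ (k≡4⇒10≤n refl) (≤-trans (≤-reflexive n≡) (+-monoʳ-≤ 8 (small ≤-refl)))
      ... | inj₁ k<4 with ≤-antisym (s≤s⁻¹ k<4) 3≤k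
      ... | refl = <⇒≱ (k≡3⇒8≤n refl) (≤-trans (≤-reflexive n≡) (+-monoʳ-≤ 6 (small (s≤s (s≤s (s≤s z≤n))))))

  -- The separate `D` lets each case keep its own formula for the diameter; the side conditions form
  -- one product for `linear`.
  large-remainder : ∀ q {e} W {D} → Odd k ⊎ Even k → n ≡ q * k + e →
          e < k × 2 * W ≤ q + e × q + e ≤ 2 * W + 1 × q + k ≤ 2 * W + e × D ≡ 2 + W → Diam n k D
  large-remainder q W parity n≡ (e<k , p₁ , p₂ , p₃ , refl) =
    diameter-large-remainder {q = q} n≡ e<k 3≤k (k≤2q {q} n≡ e<k parity) (2≤q {q} n≡ e<k) {W} p₁ p₂ p₃

  small-remainder : ∀ q {e} W {D} → Odd k ⊎ Even k → Odd q ⊎ (k ≤ 4 → e ≤ 1) → n ≡ q * k + e →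
          e < k × 1 ≤ e × 2 * W + e ≤ q + k + 1 × 2 * W + 2 ≤ q + k + e ×
            q + e ≤ 2 * W + 1 × q + k ≤ 2 * W + e × D ≡ 2 + W →
          Diam n k D
  small-remainder q W parity q-odd n≡ (e<k , 1≤e , p₁ , p₂ , p₃ , p₄ , refl) =
    diameter-small-remainder {q = q} n≡ e<k 3≤k (k≤2q {q} n≡ e<k parity) (2≤q {q} n≡ e<k) {W}
      (3≤q {q} n≡ e<k parity q-odd) 1≤e p₁ p₂ (short-generic {q = q} n≡ e<k p₃ p₄)

  no-remainder : ∀ q {e} W {D} → Odd k ⊎ Even k → Odd q ⊎ (k ≤ 4 → e ≤ 1) → n ≡ q * k + e →
          e < k × e ≡ 0 × 2 * W + 1 ≤ q + k × q + k ≤ 2 * W + 2 × D ≡ 2 + W → Diam n k D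
  no-remainder q W parity q-odd n≡ (e<k , e≡0 , p₁ , p₂ , refl) =
    diameter-no-remainder {q = q} n≡ e<k 3≤k (k≤2q {q} n≡ e<k parity) (2≤q {q} n≡ e<k) {W}
      (3≤q {q} n≡ e<k parity q-odd) e≡0 p₁ p₂

  remainder-one-odd : ∀ m t {D} → k ≡ 1 + 2 * t → n ≡ (1 + 2 * m) * k + 1 → D ≡ 2 + (m + t + 1) → Diam n k D
  remainder-one-odd m t k≡ n≡ refl =
    diameter-remainder-one-odd {q = q} n≡ 1<k 3≤k (k≤2q {q} n≡ 1<k (inj₁ (t , k≡))) (2≤q {q} n≡ 1<k) m t
      (3≤q {q} n≡ 1<k (inj₁ (t , k≡)) (inj₁ (m , refl))) refl refl k≡ refl
    where
    q = 1 + 2 * m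
    1<k = ≤-trans (s≤s (s≤s z≤n)) 3≤k

  remainder-one-even : ∀ q W {D} → Even k → n ≡ q * k + 1 →
             2 * W + 1 ≤ q + k + 1 × 2 * W + 2 ≤ q + k + 1 × q + 1 ≤ 2 * W + 1 ×
               q + k ≤ 2 * W + 2 × D ≡ 2 + W →
             Diam n k D
  remainder-one-even q W even n≡ (p₁ , p₂ , p₃ , p₄ , refl) =
    diameter-small-remainder {q = q} n≡ 1<k 3≤k (k≤2q {q} n≡ 1<k (inj₂ even)) (2≤q {q} n≡ 1<k) {W}
      (3≤q {q} n≡ 1<k (inj₂ even) (inj₂ λ _ → ≤-refl)) ≤-refl p₁ p₂ (short-even {q = q} n≡ 1<k p₃ refl even p₄)
    where
    1<k = ≤-trans (s≤s (s≤s z≤n)) 3≤k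

  -- The threshold 2 e = k + 1 is where (q + e) / 2 overtakes (q + 1 + k - e) / 2; the first part
  -- collects boundary values of j.
  k-odd-n-even-high : (m j : ℕ) → Odd k → n ≡ 2 * (m * k + j) → k ≤ 2 * j + 1 → j < k →
    ((2 * j + 1 ≡ k ⊎ 2 * j ≡ k + 1) → Diam n k (m + 2 + j)) ×
    (3 ≤ 2 * j ∸ k → 2 * (2 * j ∸ k) ≤ k + 1 → Diam n k (m + 3 + (k ∸ j))) ×
    (k + 1 < 2 * (2 * j ∸ k) → Diam n k (m + 2 + (j ∸ (k ∸ 1) / 2)))
  k-odd-n-even-high m j odd n≡ _ j<k = part₁ , part₂ , part₃
    where
    h = (k ∸ 1) / 2
    e = 2 * j ∸ k
    part₁ : 2 * j + 1 ≡ k ⊎ 2 * j ≡ k + 1 → Diam n k (m + 2 + j)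
    -- The quotient is still 2 m, with the largest remainder k - 1.
    part₁ (inj₁ 2j+1≡k) = large-remainder (2 * m) (m + j) (inj₁ odd) (even-quotient₀ m j n≡)
      (linear (m ∷ j ∷ k ∷ [])
        (λ m j k → let q = 2 ⊛ m ; e = 2 ⊛ j ; W = m ⊕ j in
           con 3 ≼ k ⇒ 2 ⊛ j ⊕ con 1 ≗ k ⇒
           con 1 ⊕ e ≼ k & 2 ⊛ W ≼ q ⊕ e & q ⊕ e ≼ 2 ⊛ W ⊕ con 1 & q ⊕ k ≼ 2 ⊛ W ⊕ e &
           ⊢ m ⊕ con 2 ⊕ j ≗ con 2 ⊕ W) refl
        3≤k 2j+1≡k)
    -- The remainder is 1, with q and k both odd.
    part₁ (inj₂ 2j≡k+1) = remainder-one-odd m h (sym (halve-odd-∸1 odd))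
      (odd-quotient₀ m j n≡ (sym 2j≡k+1))
      (linear (m ∷ j ∷ k ∷ h ∷ [])
        (λ m j k h → 2 ⊛ j ≗ k ⊕ con 1 ⇒ con 1 ⊕ 2 ⊛ h ≗ k ⇒ ⊢ m ⊕ con 2 ⊕ j ≗ con 2 ⊕ (m ⊕ h ⊕ con 1)) refl
        2j≡k+1 (halve-odd-∸1 odd))
    part₂ : 3 ≤ e → 2 * e ≤ k + 1 → Diam n k (m + 3 + (k ∸ j))
    part₂ 3≤e 2e≤k+1 = small-remainder (1 + 2 * m) (m + 1 + (k ∸ j)) (inj₁ odd) (inj₁ (m , refl))
      (odd-quotient₀ m j n≡ k+e≡)
      (linear (m ∷ j ∷ k ∷ e ∷ k ∸ j ∷ [])
        (λ m j k e f → let q = con 1 ⊕ 2 ⊛ m ; W = m ⊕ con 1 ⊕ f in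
           con 3 ≼ e ⇒ 2 ⊛ e ≼ k ⊕ con 1 ⇒ k ⊕ e ≗ 2 ⊛ j ⇒ con 1 ⊕ j ≼ k ⇒ j ⊕ f ≗ k ⇒
           con 1 ⊕ e ≼ k & con 1 ≼ e & 2 ⊛ W ⊕ e ≼ q ⊕ k ⊕ con 1 & 2 ⊛ W ⊕ con 2 ≼ q ⊕ k ⊕ e &
           q ⊕ e ≼ 2 ⊛ W ⊕ con 1 & q ⊕ k ≼ 2 ⊛ W ⊕ e & ⊢ m ⊕ con 3 ⊕ f ≗ con 2 ⊕ W) refl
        3≤e 2e≤k+1 k+e≡ j<k (m+[n∸m]≡n (<⇒≤ j<k)))
      where
      k+e≡ = n+[m∸n]≡m {2 * j} {k} (≤-trans (s≤s z≤n) 3≤e)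
    part₃ : k + 1 < 2 * e → Diam n k (m + 2 + (j ∸ h))
    part₃ k+1<2e = large-remainder (1 + 2 * m) (m + (j ∸ h)) (inj₁ odd) (odd-quotient₀ m j n≡ k+e≡)
      (linear (m ∷ j ∷ k ∷ e ∷ h ∷ j ∸ h ∷ [])
        (λ m j k e h g → let q = con 1 ⊕ 2 ⊛ m ; W = m ⊕ g in
           con 1 ⊕ (k ⊕ con 1) ≼ 2 ⊛ e ⇒ k ⊕ e ≗ 2 ⊛ j ⇒ con 1 ⊕ j ≼ k ⇒ con 1 ⊕ 2 ⊛ h ≗ k ⇒ h ⊕ g ≗ j ⇒
           con 1 ⊕ e ≼ k & 2 ⊛ W ≼ q ⊕ e & q ⊕ e ≼ 2 ⊛ W ⊕ con 1 & q ⊕ k ≼ 2 ⊛ W ⊕ e &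
           ⊢ m ⊕ con 2 ⊕ g ≗ con 2 ⊕ W) refl
        k+1<2e k+e≡ j<k (halve-odd-∸1 odd) h+g≡j)
      where
      k+e≡ = n+[m∸n]≡m {2 * j} {k}
        (linear (k ∷ e ∷ [])
          (λ k e → con 1 ⊕ (k ⊕ con 1) ≼ 2 ⊛ e ⇒ ⊢ con 1 ≼ e) refl
          k+1<2e)
      h+g≡j = m+[n∸m]≡n
        (linear (j ∷ k ∷ e ∷ h ∷ [])
          (λ j k e h → k ⊕ e ≗ 2 ⊛ j ⇒ con 1 ⊕ 2 ⊛ h ≗ k ⇒ ⊢ h ≼ j) refl
          k+e≡ (halve-odd-∸1 odd))

  k-odd-n-even-low : (m j : ℕ) → Odd k → n ≡ 2 * (m * k + j) → 2 * j < k ∸ 1 →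
    ((j ≡ 0 ⊎ j ≡ 1) → Diam n k (m + 1 + (k + 1) / 2)) ×
    (4 ≤ 2 * j → 2 * (2 * j) ≤ k + 1 → Diam n k (m + 3 + ((k ∸ 1) / 2 ∸ j))) ×
    (k + 1 < 2 * (2 * j) → Diam n k (m + 2 + j))
  k-odd-n-even-low m j odd n≡ 2j<k∸1 = part₁ , part₂ , part₃
    where
    h = (k ∸ 1) / 2
    2j<2h : 2 * j < 2 * h
    2j<2h = subst (2 * j <_) (cong (_∸ 1) (sym (halve-odd-∸1 odd))) 2j<k∸1
    -- For k ≤ 4 only j = 0 remains, as required to exclude q = 2.
    no-small : k ≤ 4 → 2 * j ≤ 1
    no-small k≤4 = ≤-trans (*-monoʳ-≤ 2 j≤0) z≤n
      where
      h≤1 : h ≤ 1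
      h≤1 =
        linear (k ∷ h ∷ [])
          (λ k h → k ≼ con 4 ⇒ con 1 ⊕ 2 ⊛ h ≗ k ⇒ ⊢ h ≼ con 1) refl
          k≤4 (halve-odd-∸1 odd)
      j≤0 : j ≤ 0
      j≤0 = s≤s⁻¹ (≤-trans (*-cancelˡ-< 2 j h 2j<2h) h≤1)
    part₁ : j ≡ 0 ⊎ j ≡ 1 → Diam n k (m + 1 + (k + 1) / 2)
    part₁ (inj₁ j≡0) = no-remainder (2 * m) (m + h) (inj₁ odd)
      (inj₂ λ _ → ≤-trans (≤-reflexive (cong (2 *_) j≡0)) z≤n)
      (even-quotient₀ m j n≡)
      (linear (m ∷ j ∷ k ∷ h ∷ (k + 1) / 2 ∷ [])
        (λ m j k h u → let q = 2 ⊛ m ; e = 2 ⊛ j ; W = m ⊕ h in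
           con 3 ≼ k ⇒ j ≗ con 0 ⇒ con 1 ⊕ 2 ⊛ h ≗ k ⇒ 2 ⊛ u ≗ k ⊕ con 1 ⇒
           con 1 ⊕ e ≼ k & e ≗ con 0 & 2 ⊛ W ⊕ con 1 ≼ q ⊕ k & q ⊕ k ≼ 2 ⊛ W ⊕ con 2 &
           ⊢ m ⊕ con 1 ⊕ u ≗ con 2 ⊕ W) refl
        3≤k j≡0 (halve-odd-∸1 odd) (halve-odd-+1 odd))
    -- The remainder is 2, and (q + 1 + k - e) / 2 equals the value for e = 0.
    part₁ (inj₂ j≡1) = small-remainder (2 * m) (m + h) (inj₁ odd) (inj₂ no-small)
      (even-quotient₀ m j n≡)
      (linear (m ∷ j ∷ k ∷ h ∷ (k + 1) / 2 ∷ [])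
        (λ m j k h u → let q = 2 ⊛ m ; e = 2 ⊛ j ; W = m ⊕ h in
           con 3 ≼ k ⇒ j ≗ con 1 ⇒ con 1 ⊕ 2 ⊛ h ≗ k ⇒ con 1 ⊕ 2 ⊛ j ≼ 2 ⊛ h ⇒ 2 ⊛ u ≗ k ⊕ con 1 ⇒
           con 1 ⊕ e ≼ k & con 1 ≼ e & 2 ⊛ W ⊕ e ≼ q ⊕ k ⊕ con 1 & 2 ⊛ W ⊕ con 2 ≼ q ⊕ k ⊕ e &
           q ⊕ e ≼ 2 ⊛ W ⊕ con 1 & q ⊕ k ≼ 2 ⊛ W ⊕ e & ⊢ m ⊕ con 1 ⊕ u ≗ con 2 ⊕ W) refl
        3≤k j≡1 (halve-odd-∸1 odd) 2j<2h (halve-odd-+1 odd))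
    part₂ : 4 ≤ 2 * j → 2 * (2 * j) ≤ k + 1 → Diam n k (m + 3 + (h ∸ j))
    part₂ 4≤2j 4j≤k+1 = small-remainder (2 * m) (m + 1 + (h ∸ j)) (inj₁ odd) (inj₂ no-small)
      (even-quotient₀ m j n≡)
      (linear (m ∷ j ∷ k ∷ h ∷ h ∸ j ∷ [])
        (λ m j k h g → let q = 2 ⊛ m ; e = 2 ⊛ j ; W = m ⊕ con 1 ⊕ g in
           con 4 ≼ 2 ⊛ j ⇒ 2 ⊛ (2 ⊛ j) ≼ k ⊕ con 1 ⇒ con 1 ⊕ 2 ⊛ h ≗ k ⇒ j ⊕ g ≗ h ⇒
           con 1 ⊕ e ≼ k & con 1 ≼ e & 2 ⊛ W ⊕ e ≼ q ⊕ k ⊕ con 1 & 2 ⊛ W ⊕ con 2 ≼ q ⊕ k ⊕ e &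
           q ⊕ e ≼ 2 ⊛ W ⊕ con 1 & q ⊕ k ≼ 2 ⊛ W ⊕ e & ⊢ m ⊕ con 3 ⊕ g ≗ con 2 ⊕ W) refl
        4≤2j 4j≤k+1 (halve-odd-∸1 odd) j+g≡h)
      where
      j+g≡h : j + (h ∸ j) ≡ h
      j+g≡h = m+[n∸m]≡n {j} {h} (*-cancelˡ-≤ 2 (<⇒≤ 2j<2h))
    part₃ : k + 1 < 2 * (2 * j) → Diam n k (m + 2 + j)
    part₃ k+1<4j = large-remainder (2 * m) (m + j) (inj₁ odd) (even-quotient₀ m j n≡)
      (linear (m ∷ j ∷ k ∷ h ∷ [])
        (λ m j k h → let q = 2 ⊛ m ; e = 2 ⊛ j ; W = m ⊕ j in
           con 1 ⊕ (k ⊕ con 1) ≼ 2 ⊛ (2 ⊛ j) ⇒ con 1 ⊕ 2 ⊛ h ≗ k ⇒ con 1 ⊕ 2 ⊛ j ≼ 2 ⊛ h ⇒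
           con 1 ⊕ e ≼ k & 2 ⊛ W ≼ q ⊕ e & q ⊕ e ≼ 2 ⊛ W ⊕ con 1 & q ⊕ k ≼ 2 ⊛ W ⊕ e &
           ⊢ m ⊕ con 2 ⊕ j ≗ con 2 ⊕ W) refl
        k+1<4j (halve-odd-∸1 odd) 2j<2h)

  k-odd-n-odd-high : (m j : ℕ) → Odd k → n ≡ 2 * (m * k + j) + 1 → k ≤ 2 * j + 2 → j < k →
    (2 * j + 1 ≡ k → Diam n k (m + 2 + (k ∸ 1) / 2)) ×
    (2 ≤ 2 * j + 1 ∸ k → 2 * (2 * j + 1 ∸ k) ≤ k + 1 → Diam n k (m + 2 + (k ∸ j))) ×
    (k + 1 < 2 * (2 * j + 1 ∸ k) → Diam n k (m + 2 + (j ∸ (k ∸ 1) / 2)))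
  k-odd-n-odd-high m j odd n≡ _ j<k = part₁ , part₂ , part₃
    where
    h = (k ∸ 1) / 2
    e = 2 * j + 1 ∸ k
    part₁ : 2 * j + 1 ≡ k → Diam n k (m + 2 + h)
    part₁ 2j+1≡k = no-remainder (1 + 2 * m) (m + h) (inj₁ odd) (inj₁ (m , refl))
      (odd-quotient₁ m j n≡ (trans (+-identityʳ k) (sym 2j+1≡k)))
      (linear (m ∷ j ∷ k ∷ h ∷ [])
        (λ m j k h → let q = con 1 ⊕ 2 ⊛ m ; e = con 0 ; W = m ⊕ h in
           con 3 ≼ k ⇒ 2 ⊛ j ⊕ con 1 ≗ k ⇒ con 1 ⊕ 2 ⊛ h ≗ k ⇒
           con 1 ⊕ e ≼ k & e ≗ con 0 & 2 ⊛ W ⊕ con 1 ≼ q ⊕ k & q ⊕ k ≼ 2 ⊛ W ⊕ con 2 &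
           ⊢ m ⊕ con 2 ⊕ h ≗ con 2 ⊕ W) refl
        3≤k 2j+1≡k (halve-odd-∸1 odd))
    part₂ : 2 ≤ e → 2 * e ≤ k + 1 → Diam n k (m + 2 + (k ∸ j))
    part₂ 2≤e 2e≤k+1 = small-remainder (1 + 2 * m) (m + (k ∸ j)) (inj₁ odd) (inj₁ (m , refl))
      (odd-quotient₁ m j n≡ k+e≡)
      (linear (m ∷ j ∷ k ∷ e ∷ k ∸ j ∷ [])
        (λ m j k e f → let q = con 1 ⊕ 2 ⊛ m ; W = m ⊕ f in
           con 2 ≼ e ⇒ 2 ⊛ e ≼ k ⊕ con 1 ⇒ k ⊕ e ≗ 2 ⊛ j ⊕ con 1 ⇒ con 1 ⊕ j ≼ k ⇒ j ⊕ f ≗ k ⇒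
           con 1 ⊕ e ≼ k & con 1 ≼ e & 2 ⊛ W ⊕ e ≼ q ⊕ k ⊕ con 1 & 2 ⊛ W ⊕ con 2 ≼ q ⊕ k ⊕ e &
           q ⊕ e ≼ 2 ⊛ W ⊕ con 1 & q ⊕ k ≼ 2 ⊛ W ⊕ e & ⊢ m ⊕ con 2 ⊕ f ≗ con 2 ⊕ W) refl
        2≤e 2e≤k+1 k+e≡ j<k (m+[n∸m]≡n (<⇒≤ j<k)))
      where
      k+e≡ = n+[m∸n]≡m {2 * j + 1} {k} (≤-trans (s≤s z≤n) 2≤e)
    part₃ : k + 1 < 2 * e → Diam n k (m + 2 + (j ∸ h))
    part₃ k+1<2e = large-remainder (1 + 2 * m) (m + (j ∸ h)) (inj₁ odd) (odd-quotient₁ m j n≡ k+e≡)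
      (linear (m ∷ j ∷ k ∷ e ∷ h ∷ j ∸ h ∷ [])
        (λ m j k e h g → let q = con 1 ⊕ 2 ⊛ m ; W = m ⊕ g in
           con 1 ⊕ (k ⊕ con 1) ≼ 2 ⊛ e ⇒ k ⊕ e ≗ 2 ⊛ j ⊕ con 1 ⇒ con 1 ⊕ j ≼ k ⇒ con 1 ⊕ 2 ⊛ h ≗ k ⇒ h ⊕ g ≗ j ⇒
           con 1 ⊕ e ≼ k & 2 ⊛ W ≼ q ⊕ e & q ⊕ e ≼ 2 ⊛ W ⊕ con 1 & q ⊕ k ≼ 2 ⊛ W ⊕ e &
           ⊢ m ⊕ con 2 ⊕ g ≗ con 2 ⊕ W) refl
        k+1<2e k+e≡ j<k (halve-odd-∸1 odd) h+g≡j)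
      where
      k+e≡ = n+[m∸n]≡m {2 * j + 1} {k}
        (linear (k ∷ e ∷ [])
          (λ k e → con 1 ⊕ (k ⊕ con 1) ≼ 2 ⊛ e ⇒ ⊢ con 1 ≼ e) refl
          k+1<2e)
      h+g≡j = m+[n∸m]≡n
        (linear (j ∷ k ∷ e ∷ h ∷ [])
          (λ j k e h → k ⊕ e ≗ 2 ⊛ j ⊕ con 1 ⇒ con 1 ⊕ 2 ⊛ h ≗ k ⇒ ⊢ h ≼ j) refl
          k+e≡ (halve-odd-∸1 odd))

  k-odd-n-odd-low : (m j : ℕ) → Odd k → n ≡ 2 * (m * k + j) + 1 → 2 * j + 2 < k →
    (1 ≤ 2 * j + 1 → 2 * (2 * j + 1) ≤ k + 1 → Diam n k (m + 2 + ((k ∸ 1) / 2 ∸ j))) ×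
    (k + 1 < 2 * (2 * j + 1) → Diam n k (m + 2 + j))
  k-odd-n-odd-low m j odd n≡ 2j+2<k = part₁ , part₂
    where
    h = (k ∸ 1) / 2
    part₁ : 1 ≤ 2 * j + 1 → 2 * (2 * j + 1) ≤ k + 1 → Diam n k (m + 2 + (h ∸ j))
    part₁ _ 4j+2≤k+1 = small-remainder (2 * m) (m + (h ∸ j)) (inj₁ odd)
      (inj₂ (λ k≤4 → +-monoˡ-≤ 1 (*-monoʳ-≤ 2
        (linear (k ∷ j ∷ [])
          (λ k j → k ≼ con 4 ⇒ con 1 ⊕ (2 ⊛ j ⊕ con 2) ≼ k ⇒ ⊢ j ≼ con 0) refl
          k≤4 2j+2<k))))
      (even-quotient₁ m j n≡)
      (linear (m ∷ j ∷ k ∷ h ∷ h ∸ j ∷ [])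
        (λ m j k h g → let q = 2 ⊛ m ; e = 2 ⊛ j ⊕ con 1 ; W = m ⊕ g in
           2 ⊛ (2 ⊛ j ⊕ con 1) ≼ k ⊕ con 1 ⇒ con 1 ⊕ (2 ⊛ j ⊕ con 2) ≼ k ⇒ con 1 ⊕ 2 ⊛ h ≗ k ⇒ j ⊕ g ≗ h ⇒
           con 1 ⊕ e ≼ k & con 1 ≼ e & 2 ⊛ W ⊕ e ≼ q ⊕ k ⊕ con 1 & 2 ⊛ W ⊕ con 2 ≼ q ⊕ k ⊕ e &
           q ⊕ e ≼ 2 ⊛ W ⊕ con 1 & q ⊕ k ≼ 2 ⊛ W ⊕ e & ⊢ m ⊕ con 2 ⊕ g ≗ con 2 ⊕ W) refl
        4j+2≤k+1 2j+2<k (halve-odd-∸1 odd) j+g≡h)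
      where
      j+g≡h = m+[n∸m]≡n
        (linear (j ∷ k ∷ h ∷ [])
          (λ j k h → con 1 ⊕ (2 ⊛ j ⊕ con 2) ≼ k ⇒ con 1 ⊕ 2 ⊛ h ≗ k ⇒ ⊢ j ≼ h) refl
          2j+2<k (halve-odd-∸1 odd))
    part₂ : k + 1 < 2 * (2 * j + 1) → Diam n k (m + 2 + j)
    part₂ k+1<4j+2 = large-remainder (2 * m) (m + j) (inj₁ odd) (even-quotient₁ m j n≡)
      (linear (m ∷ j ∷ k ∷ [])
        (λ m j k → let q = 2 ⊛ m ; e = 2 ⊛ j ⊕ con 1 ; W = m ⊕ j in
           con 1 ⊕ (k ⊕ con 1) ≼ 2 ⊛ (2 ⊛ j ⊕ con 1) ⇒ con 1 ⊕ (2 ⊛ j ⊕ con 2) ≼ k ⇒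
           con 1 ⊕ e ≼ k & 2 ⊛ W ≼ q ⊕ e & q ⊕ e ≼ 2 ⊛ W ⊕ con 1 & q ⊕ k ≼ 2 ⊛ W ⊕ e &
           ⊢ m ⊕ con 2 ⊕ j ≗ con 2 ⊕ W) refl
        k+1<4j+2 2j+2<k)

  k-even-n-even-high : (m j : ℕ) → Even k → n ≡ 2 * (m * k + j) → k ≤ 2 * j + 2 → j < k →
    ((2 * j + 2 ≡ k ⊎ 2 * j ≡ k) → Diam n k (m + 2 + j)) ×
    (2 ≤ 2 * j ∸ k → 2 * (2 * j ∸ k) ≤ k → Diam n k (m + 3 + (k ∸ j))) ×
    (k + 2 ≤ 2 * (2 * j ∸ k) → Diam n k (m + 2 + (j ∸ k / 2)))
  k-even-n-even-high m j even n≡ _ j<k = part₁ , part₂ , part₃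
    where
    h = k / 2
    e = 2 * j ∸ k
    part₁ : 2 * j + 2 ≡ k ⊎ 2 * j ≡ k → Diam n k (m + 2 + j)
    part₁ (inj₁ 2j+2≡k) = large-remainder (2 * m) (m + j) (inj₂ even) (even-quotient₀ m j n≡)
      (linear (m ∷ j ∷ k ∷ [])
        (λ m j k → let q = 2 ⊛ m ; e = 2 ⊛ j ; W = m ⊕ j in
           con 1 ≼ j ⇒ 2 ⊛ j ⊕ con 2 ≗ k ⇒
           con 1 ⊕ e ≼ k & 2 ⊛ W ≼ q ⊕ e & q ⊕ e ≼ 2 ⊛ W ⊕ con 1 & q ⊕ k ≼ 2 ⊛ W ⊕ e &
           ⊢ m ⊕ con 2 ⊕ j ≗ con 2 ⊕ W) refl
        1≤j 2j+2≡k)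
      where
      1≤j = linear (j ∷ k ∷ []) (λ j k → con 3 ≼ k ⇒ 2 ⊛ j ⊕ con 2 ≗ k ⇒ ⊢ con 1 ≼ j) refl 3≤k 2j+2≡k
    part₁ (inj₂ 2j≡k) = no-remainder (1 + 2 * m) (m + j) (inj₂ even) (inj₁ (m , refl))
      (odd-quotient₀ m j n≡ (trans (+-identityʳ k) (sym 2j≡k)))
      (linear (m ∷ j ∷ k ∷ [])
        (λ m j k → let q = con 1 ⊕ 2 ⊛ m ; e = con 0 ; W = m ⊕ j in
           con 3 ≼ k ⇒ 2 ⊛ j ≗ k ⇒
           con 1 ⊕ e ≼ k & e ≗ con 0 & 2 ⊛ W ⊕ con 1 ≼ q ⊕ k & q ⊕ k ≼ 2 ⊛ W ⊕ con 2 &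
           ⊢ m ⊕ con 2 ⊕ j ≗ con 2 ⊕ W) refl
        3≤k 2j≡k)
    part₂ : 2 ≤ e → 2 * e ≤ k → Diam n k (m + 3 + (k ∸ j))
    part₂ 2≤e 2e≤k = small-remainder (1 + 2 * m) (m + 1 + (k ∸ j)) (inj₂ even) (inj₁ (m , refl))
      (odd-quotient₀ m j n≡ k+e≡)
      (linear (m ∷ j ∷ k ∷ e ∷ k ∸ j ∷ [])
        (λ m j k e f → let q = con 1 ⊕ 2 ⊛ m ; W = m ⊕ con 1 ⊕ f in
           con 2 ≼ e ⇒ 2 ⊛ e ≼ k ⇒ k ⊕ e ≗ 2 ⊛ j ⇒ con 1 ⊕ j ≼ k ⇒ j ⊕ f ≗ k ⇒
           con 1 ⊕ e ≼ k & con 1 ≼ e & 2 ⊛ W ⊕ e ≼ q ⊕ k ⊕ con 1 & 2 ⊛ W ⊕ con 2 ≼ q ⊕ k ⊕ e &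
           q ⊕ e ≼ 2 ⊛ W ⊕ con 1 & q ⊕ k ≼ 2 ⊛ W ⊕ e & ⊢ m ⊕ con 3 ⊕ f ≗ con 2 ⊕ W) refl
        2≤e 2e≤k k+e≡ j<k (m+[n∸m]≡n (<⇒≤ j<k)))
      where
      k+e≡ = n+[m∸n]≡m {2 * j} {k} (≤-trans (s≤s z≤n) 2≤e)
    part₃ : k + 2 ≤ 2 * e → Diam n k (m + 2 + (j ∸ h))
    part₃ k+2≤2e = large-remainder (1 + 2 * m) (m + (j ∸ h)) (inj₂ even) (odd-quotient₀ m j n≡ k+e≡)
      (linear (m ∷ j ∷ k ∷ e ∷ h ∷ j ∸ h ∷ [])
        (λ m j k e h g → let q = con 1 ⊕ 2 ⊛ m ; W = m ⊕ g in
           k ⊕ con 2 ≼ 2 ⊛ e ⇒ k ⊕ e ≗ 2 ⊛ j ⇒ con 1 ⊕ j ≼ k ⇒ 2 ⊛ h ≗ k ⇒ h ⊕ g ≗ j ⇒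
           con 1 ⊕ e ≼ k & 2 ⊛ W ≼ q ⊕ e & q ⊕ e ≼ 2 ⊛ W ⊕ con 1 & q ⊕ k ≼ 2 ⊛ W ⊕ e &
           ⊢ m ⊕ con 2 ⊕ g ≗ con 2 ⊕ W) refl
        k+2≤2e k+e≡ j<k (halve-even even) h+g≡j)
      where
      k+e≡ = n+[m∸n]≡m {2 * j} {k} (linear (k ∷ e ∷ []) (λ k e → k ⊕ con 2 ≼ 2 ⊛ e ⇒ ⊢ con 1 ≼ e) refl k+2≤2e)
      h+g≡j = m+[n∸m]≡n
        (linear (j ∷ k ∷ e ∷ h ∷ [])
          (λ j k e h → k ⊕ e ≗ 2 ⊛ j ⇒ 2 ⊛ h ≗ k ⇒ ⊢ h ≼ j) refl
          k+e≡ (halve-even even))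

  k-even-n-even-low : (m j : ℕ) → Even k → n ≡ 2 * (m * k + j) → 2 * j + 2 < k →
    (j ≡ 0 → Diam n k (m + 1 + k / 2)) ×
    (2 ≤ 2 * j → 2 * (2 * j) ≤ k → Diam n k (m + 2 + (k / 2 ∸ j))) ×
    (k + 2 ≤ 2 * (2 * j) → Diam n k (m + 2 + j))
  k-even-n-even-low m j even n≡ 2j+2<k = part₁ , part₂ , part₃
    where
    h = k / 2
    part₁ : j ≡ 0 → Diam n k (m + 1 + h)
    -- With q = 2 m and k = 2 h, (q + k - 1) / 2 rounds down to m + h - 1.
    part₁ j≡0 = no-remainder (2 * m) (m + pred h) (inj₂ even)
      (inj₂ (λ k≤4 → ≤-trans (*-monoʳ-≤ 2
        (linear (k ∷ j ∷ [])
          (λ k j → k ≼ con 4 ⇒ con 1 ⊕ (2 ⊛ j ⊕ con 2) ≼ k ⇒ ⊢ j ≼ con 0) refl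
          k≤4 2j+2<k)) z≤n))
      (even-quotient₀ m j n≡)
      (linear (m ∷ j ∷ k ∷ h ∷ pred h ∷ [])
        (λ m j k h p → let q = 2 ⊛ m ; e = 2 ⊛ j ; W = m ⊕ p in
           con 3 ≼ k ⇒ j ≗ con 0 ⇒ 2 ⊛ h ≗ k ⇒ con 1 ⊕ p ≗ h ⇒
           con 1 ⊕ e ≼ k & e ≗ con 0 & 2 ⊛ W ⊕ con 1 ≼ q ⊕ k & q ⊕ k ≼ 2 ⊛ W ⊕ con 2 &
           ⊢ m ⊕ con 1 ⊕ h ≗ con 2 ⊕ W) refl
        3≤k j≡0 (halve-even even) 1+p≡h)
      where
      1≤h = linear (k ∷ h ∷ []) (λ k h → con 3 ≼ k ⇒ 2 ⊛ h ≗ k ⇒ ⊢ con 1 ≼ h) refl 3≤k (halve-even even)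
      1+p≡h = suc-pred h {{>-nonZero 1≤h}}
    part₂ : 2 ≤ 2 * j → 2 * (2 * j) ≤ k → Diam n k (m + 2 + (h ∸ j))
    part₂ 2≤2j 4j≤k = small-remainder (2 * m) (m + (h ∸ j)) (inj₂ even)
      (inj₂ (λ k≤4 → ≤-trans (*-monoʳ-≤ 2
        (linear (k ∷ j ∷ [])
          (λ k j → k ≼ con 4 ⇒ con 1 ⊕ (2 ⊛ j ⊕ con 2) ≼ k ⇒ ⊢ j ≼ con 0) refl
          k≤4 2j+2<k)) z≤n))
      (even-quotient₀ m j n≡)
      (linear (m ∷ j ∷ k ∷ h ∷ h ∸ j ∷ [])
        (λ m j k h g → let q = 2 ⊛ m ; e = 2 ⊛ j ; W = m ⊕ g in
           con 2 ≼ 2 ⊛ j ⇒ 2 ⊛ (2 ⊛ j) ≼ k ⇒ con 1 ⊕ (2 ⊛ j ⊕ con 2) ≼ k ⇒ 2 ⊛ h ≗ k ⇒ j ⊕ g ≗ h ⇒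
           con 1 ⊕ e ≼ k & con 1 ≼ e & 2 ⊛ W ⊕ e ≼ q ⊕ k ⊕ con 1 & 2 ⊛ W ⊕ con 2 ≼ q ⊕ k ⊕ e &
           q ⊕ e ≼ 2 ⊛ W ⊕ con 1 & q ⊕ k ≼ 2 ⊛ W ⊕ e & ⊢ m ⊕ con 2 ⊕ g ≗ con 2 ⊕ W) refl
        2≤2j 4j≤k 2j+2<k (halve-even even) j+g≡h)
      where
      j+g≡h = m+[n∸m]≡n
        (linear (j ∷ k ∷ h ∷ [])
          (λ j k h → con 1 ⊕ (2 ⊛ j ⊕ con 2) ≼ k ⇒ 2 ⊛ h ≗ k ⇒ ⊢ j ≼ h) refl
          2j+2<k (halve-even even))
    part₃ : k + 2 ≤ 2 * (2 * j) → Diam n k (m + 2 + j)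
    part₃ k+2≤4j = large-remainder (2 * m) (m + j) (inj₂ even) (even-quotient₀ m j n≡)
      (linear (m ∷ j ∷ k ∷ [])
        (λ m j k → let q = 2 ⊛ m ; e = 2 ⊛ j ; W = m ⊕ j in
           k ⊕ con 2 ≼ 2 ⊛ (2 ⊛ j) ⇒ con 1 ⊕ (2 ⊛ j ⊕ con 2) ≼ k ⇒
           con 1 ⊕ e ≼ k & 2 ⊛ W ≼ q ⊕ e & q ⊕ e ≼ 2 ⊛ W ⊕ con 1 & q ⊕ k ≼ 2 ⊛ W ⊕ e &
           ⊢ m ⊕ con 2 ⊕ j ≗ con 2 ⊕ W) refl
        k+2≤4j 2j+2<k)

  k-even-n-odd-high : (m j : ℕ) → Even k → n ≡ 2 * (m * k + j) + 1 → k ≤ 2 * j + 3 → j < k →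
    (2 * j + 2 ≡ k → Diam n k (m + 2 + (k ∸ 2) / 2)) ×
    (1 ≤ 2 * j + 1 ∸ k → 2 * (2 * j + 1 ∸ k) ≤ k → Diam n k (m + 2 + (k ∸ j))) ×
    (k + 2 ≤ 2 * (2 * j + 1 ∸ k) → Diam n k (m + 3 + (j ∸ k / 2)))
  k-even-n-odd-high m j even n≡ _ j<k = part₁ , part₂ , part₃
    where
    h = k / 2
    e = 2 * j + 1 ∸ k
    part₁ : 2 * j + 2 ≡ k → Diam n k (m + 2 + (k ∸ 2) / 2)
    part₁ 2j+2≡k = large-remainder (2 * m) (m + j) (inj₂ even) (even-quotient₁ m j n≡)
      (linear (m ∷ j ∷ k ∷ (k ∸ 2) / 2 ∷ [])
        (λ m j k u → let q = 2 ⊛ m ; e = 2 ⊛ j ⊕ con 1 ; W = m ⊕ j in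
           con 3 ≼ k ⇒ 2 ⊛ j ⊕ con 2 ≗ k ⇒ con 2 ⊕ 2 ⊛ u ≗ k ⇒
           con 1 ⊕ e ≼ k & 2 ⊛ W ≼ q ⊕ e & q ⊕ e ≼ 2 ⊛ W ⊕ con 1 & q ⊕ k ≼ 2 ⊛ W ⊕ e &
           ⊢ m ⊕ con 2 ⊕ u ≗ con 2 ⊕ W) refl
        3≤k 2j+2≡k (halve-even-∸2 even (≤-trans (s≤s (s≤s z≤n)) 3≤k)))
    part₂ : 1 ≤ e → 2 * e ≤ k → Diam n k (m + 2 + (k ∸ j))
    part₂ 1≤e 2e≤k = small-remainder (1 + 2 * m) (m + (k ∸ j)) (inj₂ even) (inj₁ (m , refl))
      (odd-quotient₁ m j n≡ k+e≡)
      (linear (m ∷ j ∷ k ∷ e ∷ k ∸ j ∷ [])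
        (λ m j k e f → let q = con 1 ⊕ 2 ⊛ m ; W = m ⊕ f in
           con 1 ≼ e ⇒ 2 ⊛ e ≼ k ⇒ k ⊕ e ≗ 2 ⊛ j ⊕ con 1 ⇒ con 1 ⊕ j ≼ k ⇒ j ⊕ f ≗ k ⇒
           con 1 ⊕ e ≼ k & con 1 ≼ e & 2 ⊛ W ⊕ e ≼ q ⊕ k ⊕ con 1 & 2 ⊛ W ⊕ con 2 ≼ q ⊕ k ⊕ e &
           q ⊕ e ≼ 2 ⊛ W ⊕ con 1 & q ⊕ k ≼ 2 ⊛ W ⊕ e & ⊢ m ⊕ con 2 ⊕ f ≗ con 2 ⊕ W) refl
        1≤e 2e≤k k+e≡ j<k (m+[n∸m]≡n (<⇒≤ j<k)))
      where
      k+e≡ = n+[m∸n]≡m {2 * j + 1} {k} 1≤e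
    part₃ : k + 2 ≤ 2 * e → Diam n k (m + 3 + (j ∸ h))
    part₃ k+2≤2e = large-remainder (1 + 2 * m) (m + 1 + (j ∸ h)) (inj₂ even)
      (odd-quotient₁ m j n≡ k+e≡)
      (linear (m ∷ j ∷ k ∷ e ∷ h ∷ j ∸ h ∷ [])
        (λ m j k e h g → let q = con 1 ⊕ 2 ⊛ m ; W = m ⊕ con 1 ⊕ g in
           k ⊕ con 2 ≼ 2 ⊛ e ⇒ k ⊕ e ≗ 2 ⊛ j ⊕ con 1 ⇒ con 1 ⊕ j ≼ k ⇒ 2 ⊛ h ≗ k ⇒ h ⊕ g ≗ j ⇒
           con 1 ⊕ e ≼ k & 2 ⊛ W ≼ q ⊕ e & q ⊕ e ≼ 2 ⊛ W ⊕ con 1 & q ⊕ k ≼ 2 ⊛ W ⊕ e &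
           ⊢ m ⊕ con 3 ⊕ g ≗ con 2 ⊕ W) refl
        k+2≤2e k+e≡ j<k (halve-even even) h+g≡j)
      where
      k+e≡ = n+[m∸n]≡m {2 * j + 1} {k}
        (linear (k ∷ e ∷ [])
          (λ k e → k ⊕ con 2 ≼ 2 ⊛ e ⇒ ⊢ con 1 ≼ e) refl
          k+2≤2e)
      h+g≡j = m+[n∸m]≡n
        (linear (j ∷ k ∷ e ∷ h ∷ [])
          (λ j k e h → k ⊕ con 2 ≼ 2 ⊛ e ⇒ k ⊕ e ≗ 2 ⊛ j ⊕ con 1 ⇒ 2 ⊛ h ≗ k ⇒ ⊢ h ≼ j) refl
          k+2≤2e k+e≡ (halve-even even))

  k-even-n-odd-low : (m j : ℕ) → Even k → n ≡ 2 * (m * k + j) + 1 → 2 * j + 3 < k →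
    (j ≡ 0 → Diam n k (m + 1 + k / 2)) ×
    (3 ≤ 2 * j + 1 → 2 * (2 * j + 1) ≤ k → Diam n k (m + 2 + (k / 2 ∸ j))) ×
    (k + 2 ≤ 2 * (2 * j + 1) → Diam n k (m + 2 + j))
  k-even-n-odd-low m j even n≡ 2j+3<k = part₁ , part₂ , part₃
    where
    h = k / 2
    part₁ : j ≡ 0 → Diam n k (m + 1 + h)
    -- The remainder is 1 and k is even, so parity lowers (q + 1 + k - e) / 2 = m + h by one.
    part₁ refl = remainder-one-even (2 * m) (m + pred h) even (even-quotient₁ m 0 n≡)
      (linear (m ∷ k ∷ h ∷ pred h ∷ [])
        (λ m k h p → let q = 2 ⊛ m ; W = m ⊕ p in
           con 3 ≼ k ⇒ 2 ⊛ h ≗ k ⇒ con 1 ⊕ p ≗ h ⇒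
           2 ⊛ W ⊕ con 1 ≼ q ⊕ k ⊕ con 1 & 2 ⊛ W ⊕ con 2 ≼ q ⊕ k ⊕ con 1 & q ⊕ con 1 ≼ 2 ⊛ W ⊕ con 1 &
           q ⊕ k ≼ 2 ⊛ W ⊕ con 2 & ⊢ m ⊕ con 1 ⊕ h ≗ con 2 ⊕ W) refl
        3≤k (halve-even even) 1+p≡h)
      where
      1≤h = linear (k ∷ h ∷ []) (λ k h → con 3 ≼ k ⇒ 2 ⊛ h ≗ k ⇒ ⊢ con 1 ≼ h) refl 3≤k (halve-even even)
      1+p≡h = suc-pred h {{>-nonZero 1≤h}}
    part₂ : 3 ≤ 2 * j + 1 → 2 * (2 * j + 1) ≤ k → Diam n k (m + 2 + (h ∸ j))
    part₂ 3≤2j+1 4j+2≤k = small-remainder (2 * m) (m + (h ∸ j)) (inj₂ even)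
      (inj₂ (λ k≤4 → +-monoˡ-≤ 1 (*-monoʳ-≤ 2
        (linear (k ∷ j ∷ [])
          (λ k j → k ≼ con 4 ⇒ con 1 ⊕ (2 ⊛ j ⊕ con 3) ≼ k ⇒ ⊢ j ≼ con 0) refl
          k≤4 2j+3<k))))
      (even-quotient₁ m j n≡)
      (linear (m ∷ j ∷ k ∷ h ∷ h ∸ j ∷ [])
        (λ m j k h g → let q = 2 ⊛ m ; e = 2 ⊛ j ⊕ con 1 ; W = m ⊕ g in
           con 3 ≼ 2 ⊛ j ⊕ con 1 ⇒ 2 ⊛ (2 ⊛ j ⊕ con 1) ≼ k ⇒ con 1 ⊕ (2 ⊛ j ⊕ con 3) ≼ k ⇒ 2 ⊛ h ≗ k ⇒ j ⊕ g ≗ h ⇒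
           con 1 ⊕ e ≼ k & con 1 ≼ e & 2 ⊛ W ⊕ e ≼ q ⊕ k ⊕ con 1 & 2 ⊛ W ⊕ con 2 ≼ q ⊕ k ⊕ e &
           q ⊕ e ≼ 2 ⊛ W ⊕ con 1 & q ⊕ k ≼ 2 ⊛ W ⊕ e & ⊢ m ⊕ con 2 ⊕ g ≗ con 2 ⊕ W) refl
        3≤2j+1 4j+2≤k 2j+3<k (halve-even even) j+g≡h)
      where
      j+g≡h = m+[n∸m]≡n
        (linear (j ∷ k ∷ h ∷ [])
          (λ j k h → con 1 ⊕ (2 ⊛ j ⊕ con 3) ≼ k ⇒ 2 ⊛ h ≗ k ⇒ ⊢ j ≼ h) refl
          2j+3<k (halve-even even))
    part₃ : k + 2 ≤ 2 * (2 * j + 1) → Diam n k (m + 2 + j)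
    part₃ k+2≤4j+2 = large-remainder (2 * m) (m + j) (inj₂ even) (even-quotient₁ m j n≡)
      (linear (m ∷ j ∷ k ∷ [])
        (λ m j k → let q = 2 ⊛ m ; e = 2 ⊛ j ⊕ con 1 ; W = m ⊕ j in
           k ⊕ con 2 ≼ 2 ⊛ (2 ⊛ j ⊕ con 1) ⇒ con 1 ⊕ (2 ⊛ j ⊕ con 3) ≼ k ⇒
           con 1 ⊕ e ≼ k & 2 ⊛ W ≼ q ⊕ e & q ⊕ e ≼ 2 ⊛ W ⊕ con 1 & q ⊕ k ≼ 2 ⊛ W ⊕ e &
           ⊢ m ⊕ con 2 ⊕ j ≗ con 2 ⊕ W) refl
        k+2≤4j+2 2j+3<k)

theorem3p1 :
  (n k : ℕ) → 3 ≤ k → 2 * k < n →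
  (k ≡ 3 → 8 ≤ n) →
  (k ≡ 4 → 10 ≤ n) →
  (Odd k → 5 ≤ k → k * (k + 1) ≤ 2 * n) →
  (Even k → 6 ≤ k → k * k ≤ 2 * n) →
  -- (1) k odd, n even, n/2 = mk+j, (k-1)/2 ≤ j < k
  ((m j : ℕ) → Odd k → n ≡ 2 * (m * k + j) → k ≤ 2 * j + 1 → j < k →
    ((2 * j + 1 ≡ k ⊎ 2 * j ≡ k + 1) → Diam n k (m + 2 + j)) ×
    (3 ≤ 2 * j ∸ k → 2 * (2 * j ∸ k) ≤ k + 1 → Diam n k (m + 3 + (k ∸ j))) ×
    (k + 1 < 2 * (2 * j ∸ k) → Diam n k (m + 2 + (j ∸ (k ∸ 1) / 2)))) ×
  -- (2) k odd, n even, n/2 = mk+j, 0 ≤ j < (k-1)/2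
  ((m j : ℕ) → Odd k → n ≡ 2 * (m * k + j) → 2 * j < k ∸ 1 →
    ((j ≡ 0 ⊎ j ≡ 1) → Diam n k (m + 1 + (k + 1) / 2)) ×
    (4 ≤ 2 * j → 2 * (2 * j) ≤ k + 1 → Diam n k (m + 3 + ((k ∸ 1) / 2 ∸ j))) ×
    (k + 1 < 2 * (2 * j) → Diam n k (m + 2 + j))) ×
  -- (3) k odd, n odd, (n-1)/2 = mk+j, (k-2)/2 ≤ j < k
  ((m j : ℕ) → Odd k → n ≡ 2 * (m * k + j) + 1 → k ≤ 2 * j + 2 → j < k →
    (2 * j + 1 ≡ k → Diam n k (m + 2 + (k ∸ 1) / 2)) ×
    (2 ≤ 2 * j + 1 ∸ k → 2 * (2 * j + 1 ∸ k) ≤ k + 1 → Diam n k (m + 2 + (k ∸ j))) ×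
    (k + 1 < 2 * (2 * j + 1 ∸ k) → Diam n k (m + 2 + (j ∸ (k ∸ 1) / 2)))) ×
  -- (4) k odd, n odd, (n-1)/2 = mk+j, 0 ≤ j < (k-2)/2
  ((m j : ℕ) → Odd k → n ≡ 2 * (m * k + j) + 1 → 2 * j + 2 < k →
    (1 ≤ 2 * j + 1 → 2 * (2 * j + 1) ≤ k + 1 → Diam n k (m + 2 + ((k ∸ 1) / 2 ∸ j))) ×
    (k + 1 < 2 * (2 * j + 1) → Diam n k (m + 2 + j))) ×
  -- (5) k even, n even, n/2 = mk+j, (k-2)/2 ≤ j < k
  ((m j : ℕ) → Even k → n ≡ 2 * (m * k + j) → k ≤ 2 * j + 2 → j < k →
    ((2 * j + 2 ≡ k ⊎ 2 * j ≡ k) → Diam n k (m + 2 + j)) ×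
    (2 ≤ 2 * j ∸ k → 2 * (2 * j ∸ k) ≤ k → Diam n k (m + 3 + (k ∸ j))) ×
    (k + 2 ≤ 2 * (2 * j ∸ k) → Diam n k (m + 2 + (j ∸ k / 2)))) ×
  -- (6) k even, n even, n/2 = mk+j, 0 ≤ j < (k-2)/2
  ((m j : ℕ) → Even k → n ≡ 2 * (m * k + j) → 2 * j + 2 < k →
    (j ≡ 0 → Diam n k (m + 1 + k / 2)) ×
    (2 ≤ 2 * j → 2 * (2 * j) ≤ k → Diam n k (m + 2 + (k / 2 ∸ j))) ×
    (k + 2 ≤ 2 * (2 * j) → Diam n k (m + 2 + j))) ×
  -- (7) k even, n odd, (n-1)/2 = mk+j, (k-3)/2 ≤ j < k
  ((m j : ℕ) → Even k → n ≡ 2 * (m * k + j) + 1 → k ≤ 2 * j + 3 → j < k →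
    (2 * j + 2 ≡ k → Diam n k (m + 2 + (k ∸ 2) / 2)) ×
    (1 ≤ 2 * j + 1 ∸ k → 2 * (2 * j + 1 ∸ k) ≤ k → Diam n k (m + 2 + (k ∸ j))) ×
    (k + 2 ≤ 2 * (2 * j + 1 ∸ k) → Diam n k (m + 3 + (j ∸ k / 2)))) ×
  -- (8) k even, n odd, (n-1)/2 = mk+j, 0 ≤ j < (k-3)/2
  ((m j : ℕ) → Even k → n ≡ 2 * (m * k + j) + 1 → 2 * j + 3 < k →
    (j ≡ 0 → Diam n k (m + 1 + k / 2)) ×
    (3 ≤ 2 * j + 1 → 2 * (2 * j + 1) ≤ k → Diam n k (m + 2 + (k / 2 ∸ j))) ×
    (k + 2 ≤ 2 * (2 * j + 1) → Diam n k (m + 2 + j)))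
theorem3p1 n k 3≤k 2k<n k≡3⇒8≤n k≡4⇒10≤n odd-bound even-bound =
  k-odd-n-even-high , k-odd-n-even-low ,
  k-odd-n-odd-high , k-odd-n-odd-low ,
  k-even-n-even-high , k-even-n-even-low ,
  k-even-n-odd-high , k-even-n-odd-low
  where open GeneralizedPetersen n k 3≤k 2k<n k≡3⇒8≤n k≡4⇒10≤n odd-bound even-bound
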